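{- Let $\mathcal{P}_1(z)=\sum_{n\ge 0} |\mathcal{S}_n\cap Av(\mathbf{4123},\mathbf{1324})|\, z^n$ be the generating function for the permutation class $Av(\mathbf{4123},\mathbf{1324})$. Then $$\mathcal{P}_1(z) = \frac{2-13z+26z^2-17z^3+4z^4-z(1-2z-z^2)\sqrt{1-4z}}{2\sqrt{1-4z}\,(1-3z+z^2)^2}.$$
   Context: A permutation $\sigma$ contains a pattern $\pi$ if some subsequence of $\sigma$ is order-isomorphic to $\pi$; otherwise $\sigma$ avoids $\pi$. For a set $B$ of patterns, $Av(B)$ is the set of permutations avoiding every element of $B$, and $\mathcal{S}_n$ is the set of permutations of length $n$ (the empty permutation is counted for $n=0$). -}

module Defs where

open import Data.Nat as ℕ using (ℕ; zero; suc; _<_; _∸_)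
open import Data.Integer as ℤ using (ℤ; +_; -[1+_])
open import Data.List using (List; []; _∷_; length; lookup; upTo; map; sum)
import Data.List as L
open import Data.Fin using (Fin; cast)
open import Data.Product using (Σ; ∃; _×_; _,_)
open import Function.Bundles using (_⇔_)
open import Relation.Binary.PropositionalEquality using (_≡_)
open import Data.List.Relation.Binary.Sublist.Propositional using (_⊆_)
open import Data.List.Relation.Binary.Permutation.Propositional using (_↭_)
open import Data.List.Relation.Unary.Unique.Propositional using (Unique)
open import Data.List.Membership.Propositional using (_∈_)

IsPerm : ℕ → List ℕ → Set
IsPerm n σ = σ ↭ upTo n

OrderIso : List ℕ → List ℕ → Set
OrderIso xs ys = Σ (length xs ≡ length ys) λ eq →
  ∀ (i j : Fin (length xs)) →
    (lookup xs i < lookup xs j) ⇔ (lookup ys (cast eq i) < lookup ys (cast eq j))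

Contains : List ℕ → List ℕ → Set
Contains σ π = ∃ λ τ → (τ ⊆ σ) × OrderIso τ π

Avoids : List ℕ → List ℕ → Set
Avoids σ π = Contains σ π → ⊥′
  where open import Data.Empty renaming (⊥ to ⊥′)

-- the patterns 4123 and 1324 (0-based values; only relative order matters)
p4123 : List ℕ
p4123 = 3 ∷ 0 ∷ 1 ∷ 2 ∷ []

p1324 : List ℕ
p1324 = 0 ∷ 2 ∷ 1 ∷ 3 ∷ []

InClass : ℕ → List ℕ → Set
InClass n σ = IsPerm n σ × Avoids σ p4123 × Avoids σ p1324

CountIs : ℕ → ℕ → Set
CountIs n c = Σ (List (List ℕ)) λ Ls →
  Unique Ls × (∀ σ → (σ ∈ Ls) ⇔ InClass n σ) × (length Ls ≡ c)

FPS : Set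
FPS = ℕ → ℤ

_⊕_ : FPS → FPS → FPS
(f ⊕ g) n = f n ℤ.+ g n

_⊖_ : FPS → FPS → FPS
(f ⊖ g) n = f n ℤ.- g n

_⊛_ : FPS → FPS → FPS
(f ⊛ g) n = L.foldr ℤ._+_ (+ 0) (map (λ k → f k ℤ.* g (n ∸ k)) (upTo (suc n)))

poly : List ℤ → FPS
poly []       n       = + 0
poly (a ∷ as) zero    = a
poly (a ∷ as) (suc n) = poly as n

_≐_ : FPS → FPS → Set
f ≐ g = ∀ n → f n ≡ g n

infixl 6 _⊕_ _⊖_
infixl 7 _⊛_
infix 4 _≐_

IsSqrt1m4z : FPS → Set
IsSqrt1m4z s = (s 0 ≡ + 1) × (s ⊛ s ≐ poly (+ 1 ∷ ℤ.- (+ 4) ∷ []))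

{-# OPTIONS --safe #-}

-- Build a permutation by appending its last entry in all possible ways.  The new value x is put into one of
-- the gaps between the values already present, and the gaps that create neither pattern are called active.
-- The active gaps ≤ x stay active; an active gap h ≥ x stays active above x only if every value below x occurs
-- after the values in [x , h) and before the values ≥ h.  For x > 0 this leaves at most one survivor h.
-- Recording the survivor belonging to each active gap x, one finds only four kinds of states, each described
-- by at most three numbers, and so an explicit generating tree (`children`).
--
-- The generating functions of the subtrees form an infinite linear system that determines them uniquely.
-- Put C = 1 + zC², q = 1 − 3z + z² and D = z √(1−4z) q².  After multiplication by D, the solution is a
-- combination of the powers C^a, C^(a+b), C^(a+b+c) and ((1−z)/(1−2z))^c, which is checked by substitution;
-- the root of the tree gives the stated formula.
module Submission where

open import Defs
open import Data.Nat using (ℕ)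
open import Data.Integer using (ℤ; +_; -_)
open import Data.List using (List; []; _∷_)
open import Data.Product using (Σ; ∃; _×_; _,_)
open import Algebra.Bundles using (CommutativeRing; RawRing)
open import Algebra.Solver.Ring.AlmostCommutativeRing using (AlmostCommutativeRing; _-Raw-AlmostCommutative⟶_; fromCommutativeRing)
open import Data.Integer using (-[1+_])
open import Data.List using (map; upTo; _++_; length)
open import Data.Nat using (zero; suc)
open import Data.Nat.ListAction using (sum)
open import Level using (0ℓ)
import Data.Nat as ℕ

-- Why at most one gap h survives above x > 0: if h < h' both survived, the value h would have to
-- occur after every value below x, being ≥ h, and before every value below x, being in [x , h');
-- and some value is below x. Why the list of active gaps with their survivors determines its own
-- future: the last entry x takes part in every new condition. For 0 < g ≤ x < k it lies in [g , k)
-- but occurs after the value 0, so k cannot survive g. For a gap above x it is a smaller value that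
-- occurs after everything else, so no value may lie above a survivor, which must then be the top
-- gap. Old survivors are therefore kept, dropped or moved to the new top, and the word itself need
-- not be consulted again. On the algebraic side nothing is divided: the system has the same
-- solution as soon as its coefficients agree degree by degree, so the denominator D is multiplied
-- into the system before the comparison.

module PowerSeries where

  -- The commutative ring of power series with integer coefficients.

  open import Data.Integer using (_+_; _*_)
  open import Data.Integer.Properties
  open import Data.Integer.Solver using (module +-*-Solver)
  open import Data.List using (foldr; applyUpTo)
  open import Data.List.Properties using (map-applyUpTo)
  open import Data.Nat using (_∸_)
  open import Function.Base using (id)
  open import Relation.Binary.PropositionalEquality
  open +-*-Solver using (solve; _:+_; _:*_; _:=_)

  const : ℤ → FPS
  const a = poly (a ∷ [])

  Z : FPS
  Z = poly (+ 0 ∷ + 1 ∷ [])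

  negate : FPS → FPS
  negate f n = - f n

  tail : FPS → FPS
  tail f n = f (ℕ.suc n)

  -- Agrees with _⊛_, and unfolds by one coefficient of the left factor.
  conv : FPS → FPS → FPS
  conv f g zero    = f 0 * g 0
  conv f g (suc n) = f 0 * g (suc n) + conv (tail f) g n

  private
    conv-terms : ∀ f g n → foldr _+_ (+ 0) (applyUpTo (λ i → f i * g (n ∸ i)) (suc n)) ≡ conv f g n
    conv-terms f g zero    = +-identityʳ _
    conv-terms f g (suc n) = cong (_+_ (f 0 * g (suc n))) (conv-terms (tail f) g n)

  ⊛-conv : ∀ f g → f ⊛ g ≐ conv f g
  ⊛-conv f g n = trans (cong (foldr _+_ (+ 0)) (map-applyUpTo id (λ k → f k * g (n ∸ k)) (suc n))) (conv-terms f g n)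

  conv-cong : ∀ {f f′ g g′} → f ≐ f′ → g ≐ g′ → conv f g ≐ conv f′ g′
  conv-cong p q zero    = cong₂ _*_ (p 0) (q 0)
  conv-cong p q (suc n) = cong₂ _+_ (cong₂ _*_ (p 0) (q (suc n))) (conv-cong (λ i → p (suc i)) q n)

  -- The mirror image of the recursion that defines `conv`; with both at hand, commutativity is a
  -- plain induction.
  conv-sucʳ : ∀ f g n → conv f g (suc n) ≡ f (suc n) * g 0 + conv f (tail g) n
  conv-sucʳ f g zero    = +-comm (f 0 * g 1) (f 1 * g 0)
  conv-sucʳ f g (suc n) = trans (cong (_+_ (f 0 * g (suc (suc n)))) (conv-sucʳ (tail f) g n))
    (solve 3 (λ a b c → a :+ (b :+ c) := b :+ (a :+ c)) refl (f 0 * g (suc (suc n))) (f (suc (suc n)) * g 0) (conv (tail f) (tail g) n))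

  conv-comm : ∀ f g → conv f g ≐ conv g f
  conv-comm f g zero    = *-comm (f 0) (g 0)
  conv-comm f g (suc n) = trans (cong₂ _+_ (*-comm (f 0) (g (suc n))) (conv-comm (tail f) g n)) (sym (conv-sucʳ g f n))

  conv-distribʳ : ∀ f g h → conv (g ⊕ h) f ≐ conv g f ⊕ conv h f
  conv-distribʳ f g h zero    = *-distribʳ-+ (f 0) (g 0) (h 0)
  conv-distribʳ f g h (suc n) = trans (cong (_+_ ((g 0 + h 0) * f (suc n))) (conv-distribʳ f (tail g) (tail h) n))
    (solve 5 (λ a b c u v → (a :+ b) :* c :+ (u :+ v) := (a :* c :+ u) :+ (b :* c :+ v)) refl
       (g 0) (h 0) (f (suc n)) (conv (tail g) f n) (conv (tail h) f n))

  conv-scale : ∀ a f g → conv (λ i → a * f i) g ≐ (λ n → a * conv f g n)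
  conv-scale a f g zero    = *-assoc a (f 0) (g 0)
  conv-scale a f g (suc n) = trans (cong (_+_ (a * f 0 * g (suc n))) (conv-scale a (tail f) g n))
    (solve 4 (λ a x y w → a :* x :* y :+ a :* w := a :* (x :* y :+ w)) refl a (f 0) (g (suc n)) (conv (tail f) g n))

  conv-assoc : ∀ f g h → conv (conv f g) h ≐ conv f (conv g h)
  conv-assoc f g h zero    = *-assoc (f 0) (g 0) (h 0)
  conv-assoc f g h (suc n) = begin
    f 0 * g 0 * h (suc n) + conv ((λ i → f 0 * g (suc i)) ⊕ conv (tail f) g) h n
      ≡⟨ cong (_+_ (f 0 * g 0 * h (suc n))) (conv-distribʳ h (λ i → f 0 * g (suc i)) (conv (tail f) g) n) ⟩
    f 0 * g 0 * h (suc n) + (conv (λ i → f 0 * g (suc i)) h n + conv (conv (tail f) g) h n)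
      ≡⟨ cong (_+_ (f 0 * g 0 * h (suc n))) (cong₂ _+_ (conv-scale (f 0) (tail g) h n) (conv-assoc (tail f) g h n)) ⟩
    f 0 * g 0 * h (suc n) + (f 0 * conv (tail g) h n + conv (tail f) (conv g h) n)
      ≡⟨ solve 5 (λ x y w u v → x :* y :* w :+ (x :* u :+ v) := x :* (y :* w :+ u) :+ v) refl
           (f 0) (g 0) (h (suc n)) (conv (tail g) h n) (conv (tail f) (conv g h) n) ⟩
    f 0 * (g 0 * h (suc n) + conv (tail g) h n) + conv (tail f) (conv g h) n ∎
    where open ≡-Reasoning

  conv-const : ∀ a g n → conv (const a) g n ≡ a * g n
  conv-const a g zero    = refl
  conv-const a g (suc n) = trans (cong (_+_ (a * g (suc n))) (zeroes n)) (+-identityʳ _)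
    where
    zeroes : ∀ n → conv (poly []) g n ≡ + 0
    zeroes zero    = refl
    zeroes (suc n) = trans (+-identityˡ _) (zeroes n)

  ⊛-zero : ∀ f g → (f ⊛ g) 0 ≡ f 0 * g 0
  ⊛-zero f g = ⊛-conv f g 0

  const-⊛ : ∀ a g n → (const a ⊛ g) n ≡ a * g n
  const-⊛ a g n = trans (⊛-conv (const a) g n) (conv-const a g n)

  Z⊛-zero : ∀ g → (Z ⊛ g) 0 ≡ + 0
  Z⊛-zero g = ⊛-zero Z g

  Z⊛-suc : ∀ g n → (Z ⊛ g) (suc n) ≡ g n
  Z⊛-suc g n = trans (⊛-conv Z g (suc n)) (trans (+-identityˡ _) (trans (conv-const (+ 1) g n) (*-identityˡ _)))

  const-*-homo : ∀ a b → const (a * b) ≐ const a ⊛ const b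
  const-*-homo a b zero    = sym (⊛-zero (const a) (const b))
  const-*-homo a b (suc n) = sym (trans (const-⊛ a (const b) (suc n)) (*-zeroʳ a))

  const-0 : ∀ n → const (+ 0) n ≡ + 0
  const-0 zero    = refl
  const-0 (suc _) = refl

  ring : CommutativeRing 0ℓ 0ℓ
  ring = record
    { Carrier = FPS
    ; _≈_ = _≐_
    ; _+_ = _⊕_
    ; _*_ = _⊛_
    ; -_  = negate
    ; 0#  = const (+ 0)
    ; 1#  = const (+ 1)
    ; isCommutativeRing = record
      { isRing = record
        { +-isAbelianGroup = record
          { isGroup = record
            { isMonoid = record
              { isSemigroup = record
                { isMagma = record
                  { isEquivalence = record
                    { refl = λ _ → refl ; sym = λ p n → sym (p n) ; trans = λ p q n → trans (p n) (q n) }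
                  ; ∙-cong = λ p q n → cong₂ _+_ (p n) (q n)
                  }
                ; assoc = λ f g h n → +-assoc (f n) (g n) (h n)
                }
              ; identity = (λ f n → trans (cong (λ c → c + f n) (const-0 n)) (+-identityˡ (f n)))
                         , (λ f n → trans (cong (_+_ (f n)) (const-0 n)) (+-identityʳ (f n)))
              }
            ; inverse = (λ f n → trans (+-inverseˡ (f n)) (sym (const-0 n)))
                      , (λ f n → trans (+-inverseʳ (f n)) (sym (const-0 n)))
            ; ⁻¹-cong = λ p n → cong -_ (p n)
            }
          ; comm = λ f g n → +-comm (f n) (g n)
          }
        ; *-cong = λ {f} {f′} {g} {g′} p q n → trans (⊛-conv f g n) (trans (conv-cong p q n) (sym (⊛-conv f′ g′ n)))
        ; *-assoc = λ f g h n → trans (trans (⊛-conv (f ⊛ g) h n) (conv-cong {g = h} (⊛-conv f g) (λ _ → refl) n))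
                      (trans (conv-assoc f g h n)
                        (sym (trans (⊛-conv f (g ⊛ h) n) (conv-cong {f} (λ _ → refl) (⊛-conv g h) n))))
        ; *-identity = (λ f n → trans (const-⊛ (+ 1) f n) (*-identityˡ (f n)))
                     , (λ f n → trans (⊛-comm f (const (+ 1)) n) (trans (const-⊛ (+ 1) f n) (*-identityˡ (f n))))
        ; distrib = (λ f g h n → trans (⊛-comm f (g ⊕ h) n) (trans (⊛-distribʳ f g h n)
                        (cong₂ _+_ (⊛-comm g f n) (⊛-comm h f n))))
                  , ⊛-distribʳ
        }
      ; *-comm = ⊛-comm
      }
    }
    where
    ⊛-comm : ∀ f g → f ⊛ g ≐ g ⊛ f
    ⊛-comm f g n = trans (⊛-conv f g n) (trans (conv-comm f g n) (sym (⊛-conv g f n)))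
    ⊛-distribʳ : ∀ f g h → (g ⊕ h) ⊛ f ≐ g ⊛ f ⊕ h ⊛ f
    ⊛-distribʳ f g h n = trans (⊛-conv (g ⊕ h) f n) (trans (conv-distribʳ f g h n)
      (sym (cong₂ _+_ (⊛-conv g f n) (⊛-conv h f n))))

  ℤ-rawRing : RawRing 0ℓ 0ℓ
  ℤ-rawRing = CommutativeRing.rawRing +-*-commutativeRing

  const-homomorphism : ℤ-rawRing -Raw-AlmostCommutative⟶ fromCommutativeRing ring
  const-homomorphism = record
    { ⟦_⟧    = const
    ; +-homo = λ { a b zero → refl ; a b (suc n) → refl }
    ; *-homo = const-*-homo
    ; -‿homo = λ { a zero → refl ; a (suc n) → refl }
    ; 0-homo = λ _ → refl
    ; 1-homo = λ _ → refl
    }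

-- The generating tree.

-- States are described by their active gaps in increasing order, leaving out the gap 0, which is always
-- active.  Write n for the top gap; an active gap may have a survivor, in the sense explained above.
--   flat b       : b gaps without survivor
--   top₁ a b     : a gaps with survivor n, b gaps without survivor, then n
--   top₂ a b c   : a gaps with survivor v, b gaps without survivor, c + 1 gaps that are their own survivors,
--                  the first of which is v, then n
--   capped a b c : as top₂ a b c, but the last gap has no survivor (and n is not active)
data Label : Set where
  flat   : ℕ → Label
  top₁   : ℕ → ℕ → Label
  top₂   : ℕ → ℕ → ℕ → Label
  capped : ℕ → ℕ → ℕ → Label

-- The children that `top₂` and `capped` share. An entry in one of the a gaps with survivor v leaves
-- the gaps up to it and its survivor, now v + 1, hence 2 + i gaps; an entry in one of the b gaps
-- leaves the a gaps and those of the b gaps up to it. No survivors remain in either case.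
below : ℕ → ℕ → List Label
below a b = map (λ i → flat (2 ℕ.+ i)) (upTo a) ++ map (λ j → flat (a ℕ.+ suc j)) (upTo b)

-- Listed by increasing gap, starting with the gap 0. An entry there keeps every active gap and adds
-- the gap 1; only the survivor n is carried on, as n + 1, and gap 1 obtains it too if n is active.
children : Label → List Label
children (flat b)       = flat (suc b) ∷ map (λ j → flat (suc j)) (upTo b)
children (top₁ a b)     = top₁ (suc a) b ∷ map (λ i → top₁ 0 (suc i)) (upTo a)
                          ++ map (λ j → flat (a ℕ.+ suc j)) (upTo b) ++ top₂ a b 0 ∷ []
children (top₂ a b c)   = top₁ 1 (a ℕ.+ b ℕ.+ suc c) ∷ below a b ++ map (capped a b) (upTo (suc c)) ++ top₂ a b (suc c) ∷ []
children (capped a b c) = flat (a ℕ.+ b ℕ.+ suc c ℕ.+ 2) ∷ below a b ++ map (capped a b) (upTo (suc c)) ++ capped a b c ∷ []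


-- The solution of the linear system, verified over a commutative ring.

module ClosedForm
  (R : CommutativeRing 0ℓ 0ℓ)
  (homomorphism : PowerSeries.ℤ-rawRing -Raw-AlmostCommutative⟶ fromCommutativeRing R)
  where

  open CommutativeRing R
  open _-Raw-AlmostCommutative⟶_ homomorphism using (⟦_⟧; 0-homo; 1-homo)
  open import Algebra.Properties.Semiring.Exp semiring using (_^_; ^-homo-*)
  open import Algebra.Properties.Group +-group using (x≈y⇒x∙y⁻¹≈ε)
  import Algebra.Solver.Ring
  import Algebra.Properties.Semiring.Exp (AlmostCommutativeRing.semiring (fromCommutativeRing R)) as E
  open import Data.Fin using (#_; zero; suc)
  open import Data.List using ([_]; foldr)
  open import Data.List.Properties using (map-++; applyUpTo-∷ʳ)
  open import Data.Maybe using (just; nothing)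
  import Data.Nat.Properties as ℕ
  import Data.Integer.Properties as ℤ
  open import Data.Vec using (_∷_; []; lookup)
  open import Function.Base using (id; _∘_)
  open import Relation.Binary.Definitions using (WeaklyDecidable)
  open import Relation.Binary.PropositionalEquality as ≡ using (_≡_)
  open import Relation.Binary.Reasoning.Setoid setoid
  open import Relation.Nullary using (yes; no)

  private
    ⟦⟧-≟ : WeaklyDecidable (λ a b → ⟦ a ⟧ ≈ ⟦ b ⟧)
    ⟦⟧-≟ a b with a ℤ.≟ b
    ... | yes ≡.refl = just refl
    ... | no _       = nothing

    module S = Algebra.Solver.Ring PowerSeries.ℤ-rawRing (fromCommutativeRing R) homomorphism ⟦⟧-≟
  open S using (Polynomial; con; var; _:+_; _:*_; _:-_; _:=_; solve) renaming (⟦_⟧ to eval)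

  -- `C` plays the Catalan series and `L` the inverse of 1 - 2Z. Only their equations are visible
  -- here, so that every verification is polynomial algebra.
  module Solution
    (Z C L : Carrier)
    (C-equation : C ≈ ⟦ + 1 ⟧ + Z * (C * C))
    (L-equation : L ≈ ⟦ + 1 ⟧ + Z * (⟦ + 2 ⟧ * L))
    where

    private
      vanish : ∀ x y {u v} → u ≈ v → x + y * (u - v) ≈ x
      vanish x y u≈v = trans (+-congˡ (trans (*-congˡ (x≈y⇒x∙y⁻¹≈ε u≈v)) (zeroʳ y))) (+-identityʳ x)

      -- How a relation u ≈ v enters a polynomial identity: the two sides differ by an explicit
      -- multiple of u - v, and the cofactor y has to be supplied.
      insert : ∀ {x x′ y u v} → u ≈ v → x ≈ x′ + y * (u - v) → x ≈ x′
      insert {x′ = x′} {y} u≈v e = trans e (vanish x′ y u≈v)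

    K : Carrier
    K = ⟦ + 1 ⟧ - Z * C

    private
      Z≈ : Z ≈ K * (⟦ + 1 ⟧ - K)
      Z≈ = sym (insert {y = Z} C-equation (solve 2 (λ x c → (con (+ 1) :- x :* c) :* (con (+ 1) :- (con (+ 1) :- x :* c))
        := x :+ x :* (c :- (con (+ 1) :+ x :* (c :* c)))) refl Z C))

      K*C≈1 : K * C ≈ ⟦ + 1 ⟧
      K*C≈1 = insert {y = ⟦ + 1 ⟧} C-equation (solve 2 (λ x c → (con (+ 1) :- x :* c) :* c
        := con (+ 1) :+ con (+ 1) :* (c :- (con (+ 1) :+ x :* (c :* c)))) refl Z C)

      inverse-L : (⟦ + 1 ⟧ - ⟦ + 2 ⟧ * Z) * L ≈ ⟦ + 1 ⟧
      inverse-L = insert {y = ⟦ + 1 ⟧} L-equation (solve 2 (λ x l → (con (+ 1) :- con (+ 2) :* x) :* l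
        := con (+ 1) :+ con (+ 1) :* (l :- (con (+ 1) :+ x :* (con (+ 2) :* l)))) refl Z L)

    -- With K = 1/C all the coefficients are polynomials in K: z = K − K², √(1−4z) = 2K − 1.
    module Poly {n : ℕ} (k : Polynomial n) where
      one z s q w D 1-k 1-z 1-2z : Polynomial n
      one  = con (+ 1)
      z    = k :* (one :- k)
      s    = con (+ 2) :* k :- one
      q    = one :- con (+ 3) :* z :+ z :* z
      w    = s :* q :* q
      D    = z :* w
      1-k  = one :- k
      1-z  = one :- z
      1-2z = one :- con (+ 2) :* z
      -- The part of `top₁ 0 b` that is free of b is y = z q (1-k)(1-2z) C + `const₁`, which
      -- simplifies to (1-z)(1-2z)(1-k)^4. Comparing the coefficients of a in the system gives (1-z)
      -- `linear₁` = z y, and the constant terms of the equation for `top₂` then give `const₂`.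
      const₁ linear₁ const₂ : Polynomial n
      const₁  = 1-k :* 1-k :* 1-2z :* (con (+ 2) :* z :- one :+ 1-z :* 1-k)
      linear₁ = z :* 1-2z :* 1-k :* 1-k :* 1-k :* 1-k
      const₂  = 1-z :* 1-2z :* 1-k :* 1-k :* 1-k :* 1-k
      -- The argument i stands for the number a of the label: the a children `top₁ 0 (suc i)`
      -- contribute the same constant each, so the solution has a term linear in a besides the
      -- powers of C.
      g₁ : (m a i : Polynomial n) → Polynomial n
      g₁ m a i = z :* q :* (q :- z :* k :* k) :* m :+ z :* q :* 1-k :* 1-2z :* a :+ linear₁ :* i :+ const₁
      g₂ g₃ : (t r s : Polynomial n) → Polynomial n
      g₂ t r u = (1-z :* w :- 1-k :* 1-k :* w :+ z :* q :* (q :* 1-k :- z :* z :* k)) :* t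
                   :+ s :* q :* 1-z :* (1-k :* 1-k :* u :- 1-z :* r) :+ const₂
      g₃ t r u = w :* (k :* t :- 1-z :* r :+ 1-k :* 1-k :* u)

    open Poly

    at₁ : (∀ {n} → Polynomial n → Polynomial n) → Carrier
    at₁ p = eval (p (var (# 0))) (K ∷ [])

    at₃ : (∀ {n} → Polynomial n → Polynomial n → Polynomial n → Polynomial n → Polynomial n) →
          Carrier → Carrier → Carrier → Carrier
    at₃ p x y v = eval (p (var (# 0)) (var (# 1)) (var (# 2)) (var (# 3))) (K ∷ x ∷ y ∷ v ∷ [])

    nat : ℕ → Carrier
    nat zero    = ⟦ + 0 ⟧
    nat (suc n) = ⟦ + 1 ⟧ + nat n

    -- Powers of (1-z)/(1-2z). As `capped a b c` occurs twice among its own children, subtracting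
    -- the equation for c from that for c + 1 leaves (1-2z) X(c+1) = (1-z) X(c) plus known terms,
    -- and these powers solve the homogeneous part.
    ρ : ℕ → Carrier
    ρ c = (at₁ 1-z * L) ^ c

    C^_∸1 : ℕ → Carrier
    C^ a ∸1 = C ^ a - ⟦ + 1 ⟧

    -- The extra `L` for `capped` is the denominator 1-2z that is already present at c = 0. It
    -- disappears from `top₂`, since Z times the sum of `L * ρ i` over i ≤ c telescopes to
    -- `ρ (suc c)` - 1.
    G : Label → Carrier
    G (flat b)       = at₁ D * C ^ suc b
    G (top₁ a b)     = at₃ g₁ (C ^ suc (a ℕ.+ b)) (C ^ suc a) (nat a)
    G (top₂ a b c)   = at₃ g₂ (C ^ (3 ℕ.+ (a ℕ.+ b ℕ.+ c))) (C ^ (a ℕ.+ b) * ρ c) (C^ a ∸1 * ρ c)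
    G (capped a b c) = at₃ g₃ (C ^ (3 ℕ.+ (a ℕ.+ b ℕ.+ c))) (C ^ (a ℕ.+ b) * (L * ρ c)) (C^ a ∸1 * (L * ρ c))

    total : List Carrier → Carrier
    total = foldr _+_ 0#

    total-++ : ∀ xs ys → total (xs ++ ys) ≈ total xs + total ys
    total-++ []       ys = sym (+-identityˡ _)
    total-++ (x ∷ xs) ys = trans (+-congˡ (total-++ xs ys)) (sym (+-assoc x _ _))

    ΣG : List Label → Carrier
    ΣG ls = total (map G ls)

    ΣG-++ : ∀ ls ls′ → ΣG (ls ++ ls′) ≈ ΣG ls + ΣG ls′
    ΣG-++ ls ls′ = trans (reflexive (≡.cong total (map-++ G ls ls′))) (total-++ (map G ls) (map G ls′))

    ΣG-upTo : ∀ (f : ℕ → Label) n → ΣG (map f (upTo (suc n))) ≈ ΣG (map f (upTo n)) + G (f n)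
    ΣG-upTo f n = begin
      ΣG (map f (upTo (suc n)))             ≡⟨ ≡.cong (ΣG ∘ map f) (≡.sym (applyUpTo-∷ʳ id n)) ⟩
      ΣG (map f (upTo n ++ [ n ]))          ≡⟨ ≡.cong ΣG (map-++ f (upTo n) [ n ]) ⟩
      ΣG (map f (upTo n) ++ [ f n ])        ≈⟨ ΣG-++ (map f (upTo n)) [ f n ] ⟩
      ΣG (map f (upTo n)) + (G (f n) + 0#)  ≈⟨ +-congˡ (+-identityʳ _) ⟩
      ΣG (map f (upTo n)) + G (f n)         ∎

    private
      down : ∀ x → x ≈ K * (C * x)
      down x = sym (trans (sym (*-assoc K C x)) (trans (*-congʳ (trans K*C≈1 1-homo)) (*-identityˡ x)))

      -- Used to express all powers of `C` in an identity through the highest one, which then is a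
      -- single variable of the solver.
      up : ∀ n → C ^ n ≈ K * C ^ suc n
      up n = down (C ^ n)

    -- Since Z C² = C - 1, each Z C^(2+j) is the difference C^(j+1) - C^j and the sum telescopes.
    -- The part y that does not depend on j is counted n times.
    Z*Σ : ∀ (f : ℕ → Label) x y → (∀ j → G (f j) ≈ x * C ^ (2 ℕ.+ j) + y) →
          ∀ n → Z * ΣG (map f (upTo n)) ≈ x * C^ n ∸1 + nat n * (Z * y)
    Z*Σ f x y hyp zero = begin
      Z * 0# ≈⟨ *-congˡ (sym 0-homo) ⟩
      Z * ⟦ + 0 ⟧ ≈⟨ solve 3 (λ u v x → u :* con (+ 0) := x :* (con (+ 1) :- con (+ 1)) :+ con (+ 0) :* v) refl Z (Z * y) x ⟩
      x * (⟦ + 1 ⟧ - ⟦ + 1 ⟧) + ⟦ + 0 ⟧ * (Z * y) ≈⟨ +-congʳ (*-congˡ (+-congʳ 1-homo)) ⟩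
      x * (1# - ⟦ + 1 ⟧) + ⟦ + 0 ⟧ * (Z * y) ∎
    Z*Σ f x y hyp (suc n) = begin
      Z * ΣG (map f (upTo (suc n))) ≈⟨ *-congˡ (trans (ΣG-upTo f n) (+-congˡ (hyp n))) ⟩
      Z * (ΣG (map f (upTo n)) + (x * t + y)) ≈⟨ distribˡ _ _ _ ⟩
      Z * ΣG (map f (upTo n)) + Z * (x * t + y) ≈⟨ +-congʳ (Z*Σ f x y hyp n) ⟩
      x * (C ^ n - ⟦ + 1 ⟧) + nat n * (Z * y) + Z * (x * t + y)
        ≈⟨ +-cong (+-congʳ (*-congˡ (+-congʳ (trans (up n) (*-congˡ (up (suc n))))))) (trans (distribˡ _ _ _) (+-congʳ (*-congʳ Z≈))) ⟩
      x * (K * (K * t) - ⟦ + 1 ⟧) + nat n * (Z * y) + (K * (⟦ + 1 ⟧ - K) * (x * t) + Z * y)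
        ≈⟨ solve 5 (λ k x t m u → x :* (k :* (k :* t) :- con (+ 1)) :+ m :* u :+ (z k :* (x :* t) :+ u)
                    := x :* (k :* t :- con (+ 1)) :+ (con (+ 1) :+ m) :* u) refl K x t (nat n) (Z * y) ⟩
      x * (K * t - ⟦ + 1 ⟧) + nat (suc n) * (Z * y) ≈⟨ +-congʳ (*-congˡ (+-congʳ (sym (up (suc n))))) ⟩
      x * C^ suc n ∸1 + nat (suc n) * (Z * y) ∎
      where t = C ^ (2 ℕ.+ n)

    Z*Σ′ : ∀ (f : ℕ → Label) x → (∀ j → G (f j) ≈ x * C ^ (2 ℕ.+ j)) →
          ∀ n → Z * ΣG (map f (upTo n)) ≈ x * C^ n ∸1
    Z*Σ′ f x hyp n = trans (Z*Σ f x 0# (λ j → trans (hyp j) (sym (+-identityʳ _))) n)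
      (trans (+-congˡ (trans (*-congˡ (zeroʳ Z)) (zeroʳ (nat n)))) (+-identityʳ _))

    G-flat : ∀ b → at₁ D + Z * ΣG (children (flat b)) ≈ G (flat b)
    G-flat b = begin
      at₁ D + Z * (at₁ D * t + ΣG (map (λ j → flat (suc j)) (upTo b)))
        ≈⟨ +-congˡ (trans (distribˡ _ _ _) (+-cong (*-congʳ Z≈) (Z*Σ′ _ (at₁ D) (λ j → refl) b))) ⟩
      at₁ D + (K * (⟦ + 1 ⟧ - K) * (at₁ D * t) + at₁ D * C^ b ∸1)
        ≈⟨ +-congˡ (+-congˡ (*-congˡ (+-congʳ (trans (up b) (*-congˡ (up (suc b))))))) ⟩
      at₁ D + (K * (⟦ + 1 ⟧ - K) * (at₁ D * t) + at₁ D * (K * (K * t) - ⟦ + 1 ⟧))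
        ≈⟨ solve 2 (λ k t → D k :+ (z k :* (D k :* t) :+ D k :* (k :* (k :* t) :- con (+ 1)))
                     := D k :* (k :* t)) refl K t ⟩
      at₁ D * (K * t) ≈⟨ *-congˡ (sym (up (suc b))) ⟩
      at₁ D * C ^ suc b ∎
      where t = C ^ (2 ℕ.+ b)

    private
      flat-shift : ∀ a j → G (flat (a ℕ.+ suc j)) ≈ at₁ D * C ^ a * C ^ (2 ℕ.+ j)
      flat-shift a j = begin
        at₁ D * C ^ suc (a ℕ.+ suc j)  ≡⟨ ≡.cong (λ i → at₁ D * C ^ i) (≡.sym (ℕ.+-suc a (suc j))) ⟩
        at₁ D * C ^ (a ℕ.+ suc (suc j)) ≈⟨ *-congˡ (^-homo-* C a (suc (suc j))) ⟩
        at₁ D * (C ^ a * C ^ (2 ℕ.+ j)) ≈⟨ sym (*-assoc _ _ _) ⟩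
        at₁ D * C ^ a * C ^ (2 ℕ.+ j) ∎

    -- The two runs give D C (C^a - 1) and D C^a (C^b - 1). Together with D this is D C^(a+b) + D (C
    -- - 1)(C^a - 1), and D (C - 1) = w (zC)² = w (1-K)².
    Z*Σ-below : ∀ a b → at₁ D + Z * ΣG (below a b) ≈ at₁ D * C ^ (a ℕ.+ b) + at₁ (λ k → w k :* 1-k k :* 1-k k) * C^ a ∸1
    Z*Σ-below a b = begin
      at₁ D + Z * ΣG (below a b)
        ≈⟨ +-congˡ (trans (*-congˡ (ΣG-++ (map (λ i → flat (2 ℕ.+ i)) (upTo a)) _)) (distribˡ _ _ _)) ⟩
      at₁ D + (Z * ΣG (map (λ i → flat (2 ℕ.+ i)) (upTo a)) + Z * ΣG (map (λ j → flat (a ℕ.+ suc j)) (upTo b)))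
        ≈⟨ +-congˡ (+-cong (Z*Σ′ _ (at₁ D * C) (λ i → sym (*-assoc _ _ _)) a) (Z*Σ′ _ (at₁ D * C ^ a) (flat-shift a) b)) ⟩
      at₁ D + (at₁ D * C * C^ a ∸1 + at₁ D * C ^ a * C^ b ∸1)
        ≈⟨ insert {y = at₁ (λ k → w k :* 1-k k) * (C ^ a - ⟦ + 1 ⟧)} K*C≈1
            (solve 4 (λ k c a b → D k :+ (D k :* c :* (a :- con (+ 1)) :+ D k :* a :* (b :- con (+ 1)))
                       := D k :* (a :* b) :+ w k :* 1-k k :* 1-k k :* (a :- con (+ 1)) :+ w k :* 1-k k :* (a :- con (+ 1)) :* (k :* c :- con (+ 1)))
               refl K C (C ^ a) (C ^ b)) ⟩
      at₁ D * (C ^ a * C ^ b) + at₁ (λ k → w k :* 1-k k :* 1-k k) * C^ a ∸1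
        ≈⟨ +-congʳ (*-congˡ (sym (^-homo-* C a b))) ⟩
      at₁ D * C ^ (a ℕ.+ b) + at₁ (λ k → w k :* 1-k k :* 1-k k) * C^ a ∸1 ∎

    private
      eval-cong : ∀ {n} (p : Polynomial n) {ε ε′} → (∀ i → lookup ε i ≈ lookup ε′ i) → eval p ε ≈ eval p ε′
      eval-cong (S.op S.[+] p p′) h = +-cong (eval-cong p h) (eval-cong p′ h)
      eval-cong (S.op S.[*] p p′) h = *-cong (eval-cong p h) (eval-cong p′ h)
      eval-cong (con c)           h = refl
      eval-cong (var i)           h = h i
      eval-cong (p S.:^ n)        h = E.^-congˡ n (eval-cong p h)
      eval-cong (S.:- p)          h = -‿cong (eval-cong p h)

      at₃-cong : ∀ (p : ∀ {n} → Polynomial n → Polynomial n → Polynomial n → Polynomial n → Polynomial n) {x x′ y y′ v v′} →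
                 x ≈ x′ → y ≈ y′ → v ≈ v′ → at₃ p x y v ≈ at₃ p x′ y′ v′
      at₃-cong p x≈ y≈ v≈ = eval-cong (p (var (# 0)) (var (# 1)) (var (# 2)) (var (# 3)))
        (λ { zero → refl ; (suc zero) → x≈ ; (suc (suc zero)) → y≈ ; (suc (suc (suc zero))) → v≈ })

      cancel-L : at₁ 1-2z * L ≈ ⟦ + 1 ⟧
      cancel-L = trans (*-congʳ (+-congˡ (-‿cong (*-congˡ (sym Z≈))))) inverse-L

      factor : ∀ r x y → r * (x * y) ≈ x * (r * y)
      factor r x y = trans (sym (*-assoc r x y)) (trans (*-congʳ (*-comm r x)) (*-assoc x r y))

      cancel-L′ : ∀ x y → at₁ 1-2z * (x * (L * y)) ≈ x * y
      cancel-L′ x y = trans (factor _ x _) (*-congˡ (trans (sym (*-assoc _ L y))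
        (trans (*-congʳ (trans cancel-L 1-homo)) (*-identityˡ y))))

      Z*-total : ∀ d x y v v′ → d + Z * (v′ + (x + (y + (v + 0#)))) ≈ (d + Z * x + Z * y) + (Z * v′ + Z * v)
      Z*-total d x y v v′ = begin
        d + Z * (v′ + (x + (y + (v + 0#)))) ≈⟨ +-congˡ (*-congˡ (+-congˡ (+-congˡ (+-congˡ (+-identityʳ v))))) ⟩
        d + Z * (v′ + (x + (y + v)))
          ≈⟨ solve 6 (λ d Z v′ x y v → d :+ Z :* (v′ :+ (x :+ (y :+ v)))
                := (d :+ Z :* x :+ Z :* y) :+ (Z :* v′ :+ Z :* v)) refl d Z v′ x y v ⟩
        (d + Z * x + Z * y) + (Z * v′ + Z * v) ∎

    ΣG-children : ∀ l ls ls′ l′ → at₁ D + Z * ΣG (l ∷ ls ++ ls′ ++ l′ ∷ []) ≈ (at₁ D + Z * ΣG ls + Z * ΣG ls′) + (Z * G l + Z * G l′)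
    ΣG-children l ls ls′ l′ = trans
      (+-congˡ (*-congˡ (+-congˡ (trans (ΣG-++ ls _) (+-congˡ (ΣG-++ ls′ _))))))
      (Z*-total (at₁ D) (ΣG ls) (ΣG ls′) (G l′) (G l))

    module _ (a b : ℕ) where
      private
        m = a ℕ.+ b

        r₃ u₃ t₃ : ℕ → Carrier
        r₃ c = C ^ m * (L * ρ c)
        u₃ c = C^ a ∸1 * (L * ρ c)
        t₃ c = C ^ (4 ℕ.+ (m ℕ.+ c))

        t₃-suc : ∀ c → C ^ (3 ℕ.+ (m ℕ.+ suc c)) ≈ t₃ c
        t₃-suc c = reflexive (≡.cong (λ i → C ^ (3 ℕ.+ i)) (ℕ.+-suc m c))

        Z*capped : ∀ c → Z * G (capped a b c) ≈ at₃ (λ k t r u → z k :* g₃ k (k :* t) r u) (t₃ c) (r₃ c) (u₃ c)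
        Z*capped c = *-cong Z≈ (at₃-cong g₃ (up (3 ℕ.+ (m ℕ.+ c))) refl refl)

        -- Read off from the equation for `capped a b c`, which says X = Y + z (D t) + z X, where Y
        -- collects D and the shared children; hence Y = (1-z) X - z D t.
        y : ∀ {n} → Polynomial n → Polynomial n → Polynomial n → Polynomial n → Polynomial n
        y k t r u = 1-z k :* g₃ k (k :* t) r u :- z k :* D k :* t

      -- By induction on c, as going from c to c + 1 adds a single child. The same sum serves
      -- `capped` and `top₂`.
      Σcapped : ∀ c → at₁ D + Z * ΣG (below a b) + Z * ΣG (map (capped a b) (upTo (suc c))) ≈ at₃ y (t₃ c) (r₃ c) (u₃ c)
      Σcapped zero = begin
        at₁ D + Z * ΣG (below a b) + Z * (G (capped a b 0) + 0#)
          ≈⟨ +-cong (Z*Σ-below a b) (trans (*-congˡ (+-identityʳ _)) (Z*capped 0)) ⟩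
        at₁ D * C ^ m + at₁ (λ k → w k :* 1-k k :* 1-k k) * C^ a ∸1 + at₃ (λ k t r u → z k :* g₃ k (k :* t) r u) t r u
          ≈⟨ +-congʳ (+-cong (*-congˡ C^m) (*-congˡ (sym (trans (cancel-L′ _ _) (*-identityʳ _))))) ⟩
        at₁ D * (K * (K * (K * (K * t)))) + at₁ (λ k → w k :* 1-k k :* 1-k k) * (at₁ 1-2z * u) + at₃ (λ k t r u → z k :* g₃ k (k :* t) r u) t r u
          ≈⟨ insert {y = at₁ (λ k → w k :* 1-z k)} (trans (trans (cancel-L′ _ _) (*-identityʳ _)) C^m)
              (solve 4 (λ k t r u → D k :* (k :* (k :* (k :* (k :* t)))) :+ w k :* 1-k k :* 1-k k :* (1-2z k :* u) :+ z k :* g₃ k (k :* t) r u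
                 := y k t r u :+ w k :* 1-z k :* (1-2z k :* r :- k :* (k :* (k :* (k :* t))))) refl K t r u) ⟩
        at₃ y t r u ∎
        where
        t = t₃ 0
        r = r₃ 0
        u = u₃ 0
        C^m : C ^ m ≈ K * (K * (K * (K * t)))
        C^m = trans (up m) (*-congˡ (trans (up (1 ℕ.+ m)) (*-congˡ (trans (up (2 ℕ.+ m)) (*-congˡ (trans (up (3 ℕ.+ m))
          (*-congˡ (reflexive (≡.cong (λ i → C ^ (4 ℕ.+ i)) (≡.sym (ℕ.+-identityʳ m)))))))))))
      Σcapped (suc c) = begin
        at₁ D + Z * ΣG (below a b) + Z * ΣG (map (capped a b) (upTo (2 ℕ.+ c)))
          ≈⟨ +-congˡ (trans (*-congˡ (ΣG-upTo (capped a b) (suc c))) (distribˡ Z _ _)) ⟩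
        at₁ D + Z * ΣG (below a b) + (Z * ΣG (map (capped a b) (upTo (suc c))) + Z * G (capped a b (suc c)))
          ≈⟨ sym (+-assoc _ _ _) ⟩
        at₁ D + Z * ΣG (below a b) + Z * ΣG (map (capped a b) (upTo (suc c))) + Z * G (capped a b (suc c))
          ≈⟨ +-cong (Σcapped c) (Z*capped (suc c)) ⟩
        at₃ y (t₃ c) (r₃ c) (u₃ c) + at₃ (λ k t r u → z k :* g₃ k (k :* t) r u) t (r₃ (suc c)) (u₃ (suc c))
          ≈⟨ +-cong (at₃-cong y (trans (up (4 ℕ.+ (m ℕ.+ c))) (*-congˡ (reflexive (≡.cong (λ i → C ^ (4 ℕ.+ i)) (≡.sym (ℕ.+-suc m c))))))
                       (sym (cancel-L″ _)) (sym (cancel-L″ _)))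
                    (at₃-cong (λ k t r u → z k :* g₃ k (k :* t) r u) refl (expand-ρ _) (expand-ρ _)) ⟩
        at₃ y (K * t) (at₁ 1-2z * r) (at₁ 1-2z * u) + at₃ (λ k t r u → z k :* g₃ k (k :* t) r u) t (at₁ 1-z * r) (at₁ 1-z * u)
          ≈⟨ solve 4 (λ k t r u → y k (k :* t) (1-2z k :* r) (1-2z k :* u) :+ z k :* g₃ k (k :* t) (1-z k :* r) (1-z k :* u)
               := y k t (1-z k :* r) (1-z k :* u)) refl K t r u ⟩
        at₃ y t (at₁ 1-z * r) (at₁ 1-z * u)
          ≈⟨ at₃-cong y refl (sym (expand-ρ _)) (sym (expand-ρ _)) ⟩
        at₃ y t (r₃ (suc c)) (u₃ (suc c)) ∎
        where
        t = t₃ (suc c)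
        -- One factor `L` more than the terms at hand: `L * ρ c` and `L * ρ (suc c)` are the
        -- multiples of `L * (L * ρ c)` by 1-2z and 1-z, so no inverse is left in the identity.
        r = C ^ m * (L * (L * ρ c))
        u = C^ a ∸1 * (L * (L * ρ c))
        cancel-L″ : ∀ x → at₁ 1-2z * (x * (L * (L * ρ c))) ≈ x * (L * ρ c)
        cancel-L″ x = cancel-L′ x (L * ρ c)
        expand-ρ : ∀ x → x * (L * ρ (suc c)) ≈ at₁ 1-z * (x * (L * (L * ρ c)))
        expand-ρ x = trans (*-congˡ (trans (*-congˡ (*-assoc _ L _)) (factor L _ _))) (factor x _ _)

      G-capped : ∀ c → at₁ D + Z * ΣG (children (capped a b c)) ≈ G (capped a b c)
      G-capped c = begin
        at₁ D + Z * ΣG (children (capped a b c))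
          ≈⟨ ΣG-children (flat (m ℕ.+ suc c ℕ.+ 2)) (below a b) (map (capped a b) (upTo (suc c))) (capped a b c) ⟩
        (at₁ D + Z * ΣG (below a b) + Z * ΣG (map (capped a b) (upTo (suc c)))) + (Z * (at₁ D * C ^ suc (m ℕ.+ suc c ℕ.+ 2)) + Z * G (capped a b c))
          ≈⟨ +-cong (Σcapped c) (+-cong (*-cong Z≈ (*-congˡ (reflexive (≡.cong (C ^_) index)))) (Z*capped c)) ⟩
        at₃ y t r u + (K * (⟦ + 1 ⟧ - K) * (at₁ D * t) + at₃ (λ k t r u → z k :* g₃ k (k :* t) r u) t r u)
          ≈⟨ solve 4 (λ k t r u → y k t r u :+ (z k :* (D k :* t) :+ z k :* g₃ k (k :* t) r u) := g₃ k (k :* t) r u) refl K t r u ⟩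
        at₃ g₃ (K * t) r u ≈⟨ at₃-cong g₃ (sym (up (3 ℕ.+ (m ℕ.+ c)))) refl refl ⟩
        G (capped a b c) ∎
        where
        t = t₃ c
        r = r₃ c
        u = u₃ c
        index : suc (m ℕ.+ suc c ℕ.+ 2) ≡ 4 ℕ.+ (m ℕ.+ c)
        index = ≡.cong suc (≡.trans (ℕ.+-comm (m ℕ.+ suc c) 2) (≡.cong (2 ℕ.+_) (ℕ.+-suc m c)))

      G-top₂ : ∀ c → at₁ D + Z * ΣG (children (top₂ a b c)) ≈ G (top₂ a b c)
      G-top₂ c = begin
        at₁ D + Z * ΣG (children (top₂ a b c))
          ≈⟨ ΣG-children (top₁ 1 (m ℕ.+ suc c)) (below a b) (map (capped a b) (upTo (suc c))) (top₂ a b (suc c)) ⟩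
        (at₁ D + Z * ΣG (below a b) + Z * ΣG (map (capped a b) (upTo (suc c)))) + (Z * G (top₁ 1 (m ℕ.+ suc c)) + Z * G (top₂ a b (suc c)))
          ≈⟨ +-cong (Σcapped c) (+-cong
               (*-cong Z≈ (at₃-cong g₁ (trans (reflexive (≡.cong (λ i → C ^ (2 ℕ.+ i)) (ℕ.+-suc m c))) (up (3 ℕ.+ (m ℕ.+ c)))) refl refl))
               (*-cong Z≈ (at₃-cong g₂ (t₃-suc c) (expand-ρ _) (expand-ρ _)))) ⟩
        at₃ y t r u + (K * (⟦ + 1 ⟧ - K) * at₃ g₁ (K * t) v (⟦ + 1 ⟧ + ⟦ + 0 ⟧) + K * (⟦ + 1 ⟧ - K) * at₃ g₂ t (at₁ 1-z * r) (at₁ 1-z * u))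
          -- C² stems from the child `top₁ 1 _` and is unrelated to t; it is eliminated by K² C² =
          -- 1.
          ≈⟨ insert {y = at₁ (λ k → 1-k k :* 1-k k :* 1-k k :* q k :* 1-2z k)} K*K*C^2
               (solve 5 (λ k t r u v → y k t r u :+ (z k :* g₁ k (k :* t) v (con (+ 1) :+ con (+ 0)) :+ z k :* g₂ k t (1-z k :* r) (1-z k :* u))
                 := g₂ k (k :* t) (1-2z k :* r) (1-2z k :* u) :+ 1-k k :* 1-k k :* 1-k k :* q k :* 1-2z k :* (k :* (k :* v) :- con (+ 1)))
                 refl K t r u v) ⟩
        at₃ g₂ (K * t) (at₁ 1-2z * r) (at₁ 1-2z * u)
          ≈⟨ at₃-cong g₂ (sym (up (3 ℕ.+ (m ℕ.+ c)))) (cancel-L′ _ _) (cancel-L′ _ _) ⟩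
        G (top₂ a b c) ∎
        where
        t = t₃ c
        r = r₃ c
        u = u₃ c
        v = C ^ 2
        expand-ρ : ∀ x → x * ρ (suc c) ≈ at₁ 1-z * (x * (L * ρ c))
        expand-ρ x = trans (*-congˡ (*-assoc _ L _)) (factor x _ _)
        K*K*C^2 : K * (K * C ^ 2) ≈ ⟦ + 1 ⟧
        K*K*C^2 = trans (*-congˡ (sym (up 1))) (trans (sym (up 0)) (sym 1-homo))

      G-top₁ : at₁ D + Z * ΣG (children (top₁ a b)) ≈ G (top₁ a b)
      G-top₁ = begin
        at₁ D + Z * ΣG (children (top₁ a b))
          ≈⟨ ΣG-children (top₁ (suc a) b) (map (λ i → top₁ 0 (suc i)) (upTo a)) (map (λ j → flat (a ℕ.+ suc j)) (upTo b)) (top₂ a b 0) ⟩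
        (at₁ D + Z * ΣG (map (λ i → top₁ 0 (suc i)) (upTo a)) + Z * ΣG (map (λ j → flat (a ℕ.+ suc j)) (upTo b))) + (Z * G (top₁ (suc a) b) + Z * G (top₂ a b 0))
          ≈⟨ +-cong (+-cong (+-congˡ (Z*Σ _ x₁ y₁ top₁-split a)) (Z*Σ′ _ (at₁ D * C ^ a) (flat-shift a) b)) (+-cong
               (*-cong Z≈ (at₃-cong g₁ (up (2 ℕ.+ m)) refl refl))
               (*-cong Z≈ (at₃-cong g₂ (reflexive (≡.cong (λ i → C ^ (3 ℕ.+ i)) (ℕ.+-identityʳ m))) (*-identityʳ _) (*-identityʳ _)))) ⟩
        (at₁ D + (x₁ * C^ a ∸1 + n * (Z * y₁)) + at₁ D * C ^ a * C^ b ∸1) + (K * (⟦ + 1 ⟧ - K) * at₃ g₁ (K * t) v (⟦ + 1 ⟧ + n) + K * (⟦ + 1 ⟧ - K) * at₃ g₂ t (C ^ m) (C^ a ∸1))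
          ≈⟨ +-cong (+-cong (+-congˡ (+-cong (*-congˡ (+-congʳ C^a)) (*-congˡ (*-congʳ Z≈)))) C^a*C^b)
                    (+-congˡ (*-congˡ (at₃-cong g₂ refl C^m (+-congʳ C^a)))) ⟩
        (at₁ D + (x₁ * (K * (K * v) - ⟦ + 1 ⟧) + n * (K * (⟦ + 1 ⟧ - K) * y₁)) + at₁ D * (K * (K * (K * t)) - K * (K * v)))
          + (K * (⟦ + 1 ⟧ - K) * at₃ g₁ (K * t) v (⟦ + 1 ⟧ + n) + K * (⟦ + 1 ⟧ - K) * at₃ g₂ t (K * (K * (K * t))) (K * (K * v) - ⟦ + 1 ⟧))
          ≈⟨ insert {y = n * at₁ (λ k → z k :* q k :* 1-k k :* 1-k k :* 1-2z k)} K*C^1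
               (solve 5 (λ k t v n c →
                  (D k :+ (z k :* q k :* (q k :- z k :* k :* k) :* (k :* (k :* v) :- con (+ 1))
                     :+ n :* (z k :* (z k :* q k :* 1-k k :* 1-2z k :* c :+ const₁ k))) :+ D k :* (k :* (k :* (k :* t)) :- k :* (k :* v)))
                  :+ (z k :* g₁ k (k :* t) v (con (+ 1) :+ n) :+ z k :* g₂ k t (k :* (k :* (k :* t))) (k :* (k :* v) :- con (+ 1)))
                  := g₁ k (k :* (k :* t)) (k :* v) n :+ n :* (z k :* q k :* 1-k k :* 1-k k :* 1-2z k) :* (k :* c :- con (+ 1)))
                refl K t v n (C ^ 1)) ⟩
        at₃ g₁ (K * (K * t)) (K * v) n
          ≈⟨ at₃-cong g₁ (trans (*-congˡ (sym (up (2 ℕ.+ m)))) (sym (up (1 ℕ.+ m)))) (sym (up (1 ℕ.+ a))) refl ⟩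
        G (top₁ a b) ∎
        where
        n = nat a
        t = C ^ (3 ℕ.+ m)
        v = C ^ (2 ℕ.+ a)
        x₁ = at₁ (λ k → z k :* q k :* (q k :- z k :* k :* k))
        y₁ = at₁ (λ k → z k :* q k :* 1-k k :* 1-2z k) * C ^ 1 + at₁ const₁
        top₁-split : ∀ i → G (top₁ 0 (suc i)) ≈ x₁ * C ^ (2 ℕ.+ i) + y₁
        top₁-split i = solve 3 (λ k x c → g₁ k x c (con (+ 0)) := z k :* q k :* (q k :- z k :* k :* k) :* x :+ (z k :* q k :* 1-k k :* 1-2z k :* c :+ const₁ k))
          refl K (C ^ (2 ℕ.+ i)) (C ^ 1)
        C^a : C ^ a ≈ K * (K * v)
        C^a = trans (up a) (*-congˡ (up (1 ℕ.+ a)))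
        C^m : C ^ m ≈ K * (K * (K * t))
        C^m = trans (up m) (*-congˡ (trans (up (1 ℕ.+ m)) (*-congˡ (up (2 ℕ.+ m)))))
        K*C^1 : K * C ^ 1 ≈ ⟦ + 1 ⟧
        K*C^1 = trans (sym (up 0)) (sym 1-homo)
        C^a*C^b : at₁ D * C ^ a * C^ b ∸1 ≈ at₁ D * (K * (K * (K * t)) - K * (K * v))
        C^a*C^b = trans (solve 3 (λ d x y → d :* x :* (y :- con (+ 1)) := d :* (x :* y :- x)) refl (at₁ D) (C ^ a) (C ^ b))
          (*-congˡ (+-cong (trans (sym (^-homo-* C a b)) C^m) (-‿cong C^a)))

    G-children : ∀ l → at₁ D + Z * ΣG (children l) ≈ G l
    G-children (flat b)       = G-flat b
    G-children (top₁ a b)     = G-top₁ a b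
    G-children (top₂ a b c)   = G-top₂ a b c
    G-children (capped a b c) = G-capped a b c

    hornerₚ : ∀ {n} → List ℤ → Polynomial n → Polynomial n
    hornerₚ []       x = con (+ 0)
    hornerₚ (a ∷ as) x = con a :+ x :* hornerₚ as x

    horner : List ℤ → Carrier
    horner as = eval (hornerₚ as (var (# 0))) (Z ∷ [])

    sqrt : Carrier
    sqrt = at₁ s

    private
      horner-K : ∀ as → horner as ≈ at₁ (λ k → hornerₚ as (z k))
      horner-K []       = refl
      horner-K (a ∷ as) = +-congˡ (*-cong Z≈ (horner-K as))

    sqrt² : sqrt * sqrt ≈ horner (+ 1 ∷ -[1+ 3 ] ∷ [])
    sqrt² = trans (solve 1 (λ k → s k :* s k := hornerₚ (+ 1 ∷ -[1+ 3 ] ∷ []) (z k)) refl K) (sym (horner-K (+ 1 ∷ -[1+ 3 ] ∷ [])))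

    -- Because D = z w and w = √(1-4z) q², the denominator times 1 + Z F is 2 (w + D F), where D F
    -- is known. The relation K C = 1 removes the last power of `C`.
    closed-form : ∀ {F P} → at₁ D * F ≈ G (top₁ 0 0) → P ≈ ⟦ + 1 ⟧ + Z * F →
      horner (+ 2 ∷ []) * sqrt * horner (+ 1 ∷ -[1+ 2 ] ∷ + 1 ∷ []) * horner (+ 1 ∷ -[1+ 2 ] ∷ + 1 ∷ []) * P
      ≈ horner (+ 2 ∷ -[1+ 12 ] ∷ + 26 ∷ -[1+ 16 ] ∷ + 4 ∷ []) - horner (+ 0 ∷ + 1 ∷ -[1+ 1 ] ∷ -[1+ 0 ] ∷ []) * sqrt
    closed-form {F} {P} F-closed P≈ = begin
      horner (+ 2 ∷ []) * sqrt * horner (+ 1 ∷ -[1+ 2 ] ∷ + 1 ∷ []) * horner (+ 1 ∷ -[1+ 2 ] ∷ + 1 ∷ []) * P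
        ≈⟨ *-cong (*-cong (*-cong (*-congʳ (horner-K (+ 2 ∷ []))) (horner-K (+ 1 ∷ -[1+ 2 ] ∷ + 1 ∷ [])))
             (horner-K (+ 1 ∷ -[1+ 2 ] ∷ + 1 ∷ []))) (trans P≈ (+-congˡ (*-congʳ Z≈))) ⟩
      at₁ (λ k → hornerₚ (+ 2 ∷ []) (z k)) * sqrt * at₁ (λ k → hornerₚ (+ 1 ∷ -[1+ 2 ] ∷ + 1 ∷ []) (z k))
          * at₁ (λ k → hornerₚ (+ 1 ∷ -[1+ 2 ] ∷ + 1 ∷ []) (z k)) * (⟦ + 1 ⟧ + K * (⟦ + 1 ⟧ - K) * F)
        ≈⟨ solve 2 (λ k f → hornerₚ (+ 2 ∷ []) (z k) :* s k :* hornerₚ (+ 1 ∷ -[1+ 2 ] ∷ + 1 ∷ []) (z k)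
             :* hornerₚ (+ 1 ∷ -[1+ 2 ] ∷ + 1 ∷ []) (z k) :* (con (+ 1) :+ z k :* f) := con (+ 2) :* (w k :+ D k :* f)) refl K F ⟩
      ⟦ + 2 ⟧ * (at₁ w + at₁ D * F) ≈⟨ *-congˡ (+-congˡ F-closed) ⟩
      ⟦ + 2 ⟧ * (at₁ w + G (top₁ 0 0))
        ≈⟨ insert {y = at₁ (λ k → con (+ 2) :* q k :* 1-k k :* (q k :- z k :* k :* k :+ 1-k k :* 1-2z k))} (trans (sym (up 0)) (sym 1-homo))
            (solve 2 (λ k c → con (+ 2) :* (w k :+ g₁ k c c (con (+ 0)))
              := hornerₚ (+ 2 ∷ -[1+ 12 ] ∷ + 26 ∷ -[1+ 16 ] ∷ + 4 ∷ []) (z k) :- hornerₚ (+ 0 ∷ + 1 ∷ -[1+ 1 ] ∷ -[1+ 0 ] ∷ []) (z k) :* s k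
                :+ con (+ 2) :* q k :* 1-k k :* (q k :- z k :* k :* k :+ 1-k k :* 1-2z k) :* (k :* c :- con (+ 1)))
              refl K (C ^ 1)) ⟩
      at₁ (λ k → hornerₚ (+ 2 ∷ -[1+ 12 ] ∷ + 26 ∷ -[1+ 16 ] ∷ + 4 ∷ []) (z k)) - at₁ (λ k → hornerₚ (+ 0 ∷ + 1 ∷ -[1+ 1 ] ∷ -[1+ 0 ] ∷ []) (z k)) * sqrt
        ≈⟨ sym (+-cong (horner-K (+ 2 ∷ -[1+ 12 ] ∷ + 26 ∷ -[1+ 16 ] ∷ + 4 ∷ [])) (-‿cong (*-congʳ (horner-K (+ 0 ∷ + 1 ∷ -[1+ 1 ] ∷ -[1+ 0 ] ∷ []))))) ⟩
      horner (+ 2 ∷ -[1+ 12 ] ∷ + 26 ∷ -[1+ 16 ] ∷ + 4 ∷ []) - horner (+ 0 ∷ + 1 ∷ -[1+ 1 ] ∷ -[1+ 0 ] ∷ []) * sqrt ∎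

descendants : ℕ → Label → ℕ
descendants zero    l = 1
descendants (suc n) l = sum (map (descendants n) (children l))

-- The series of the tree and the passage to the closed form.

module TreeSeries where

  open PowerSeries
  open import Data.Integer using (_+_; _*_)
  open import Data.Integer.Properties as ℤ using (pos-+)
  import Data.Integer as ℤ
  open import Data.List using (foldr; applyUpTo)
  open import Data.List.Properties using (map-upTo; map-∘)
  open import Data.Sum using (inj₁; inj₂)
  open import Function.Base using (_∘_)
  open import Relation.Binary.PropositionalEquality as ≡ using (_≡_; refl; cong; cong₂)
  open import Relation.Nullary using (contradiction; ¬_)
  import Data.Nat.Properties as ℕ
  module R = CommutativeRing ring

  Σ[_] : ∀ {I : Set} → (I → FPS) → List I → FPS
  Σ[ X ] is = foldr _⊕_ (const (+ 0)) (map X is)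

  Σ-cong-at : ∀ {I : Set} {X Y : I → FPS} {n} → (∀ i → X i n ≡ Y i n) → ∀ is → Σ[ X ] is n ≡ Σ[ Y ] is n
  Σ-cong-at h []       = refl
  Σ-cong-at h (i ∷ is) = cong₂ _+_ (h i) (Σ-cong-at h is)

  Σ-distribˡ : ∀ {I : Set} D (X : I → FPS) is → D ⊛ Σ[ X ] is ≐ Σ[ (λ i → D ⊛ X i) ] is
  Σ-distribˡ D X []       = R.zeroʳ D
  Σ-distribˡ D X (i ∷ is) = R.trans (R.distribˡ D (X i) (Σ[ X ] is)) (R.+-congˡ {D ⊛ X i} (Σ-distribˡ D X is))

  Solves : {I : Set} → (I → List I) → FPS → (I → FPS) → Set
  Solves ch A X = ∀ i → X i ≐ A ⊕ Z ⊛ Σ[ X ] (ch i)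

  -- The factor `Z` makes coefficient n + 1 of a series depend only on coefficients n of the series
  -- of its children, so induction on n works although the system is infinite.
  Solves-unique : ∀ {I : Set} {ch : I → List I} {A X Y} → Solves ch A X → Solves ch A Y → ∀ i → X i ≐ Y i
  Solves-unique {ch = ch} {A} {X} {Y} hX hY i zero = ≡.trans (hX i 0) (≡.trans
    (cong (_+_ (A 0)) (≡.trans (Z⊛-zero (Σ[ X ] (ch i))) (≡.sym (Z⊛-zero (Σ[ Y ] (ch i)))))) (≡.sym (hY i 0)))
  Solves-unique {ch = ch} {A} {X} {Y} hX hY i (suc n) = ≡.trans (hX i (suc n)) (≡.trans
    (cong (_+_ (A (suc n))) (≡.trans (Z⊛-suc (Σ[ X ] (ch i)) n) (≡.trans
      (Σ-cong-at (λ j → Solves-unique {ch = ch} {A} {X} {Y} hX hY j n) (ch i)) (≡.sym (Z⊛-suc (Σ[ Y ] (ch i)) n))))) (≡.sym (hY i (suc n))))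

  Solves-scale : ∀ {I : Set} (ch : I → List I) A X D → Solves ch A X → Solves ch (D ⊛ A) (λ i → D ⊛ X i)
  Solves-scale ch A X D h i = begin
    D ⊛ X i                                       ≈⟨ R.*-congˡ {D} (h i) ⟩
    D ⊛ (A ⊕ Z ⊛ Σ[ X ] (ch i))                   ≈⟨ R.distribˡ D A (Z ⊛ Σ[ X ] (ch i)) ⟩
    D ⊛ A ⊕ D ⊛ (Z ⊛ Σ[ X ] (ch i))               ≈⟨ R.+-congˡ {D ⊛ A} (x∙yz≈y∙xz D Z (Σ[ X ] (ch i))) ⟩
    D ⊛ A ⊕ Z ⊛ (D ⊛ Σ[ X ] (ch i))               ≈⟨ R.+-congˡ {D ⊛ A} (R.*-congˡ {Z} (Σ-distribˡ D X (ch i))) ⟩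
    D ⊛ A ⊕ Z ⊛ Σ[ (λ j → D ⊛ X j) ] (ch i)       ∎
    where
    open import Relation.Binary.Reasoning.Setoid R.setoid
    open import Algebra.Properties.CommutativeSemigroup R.*-commutativeSemigroup using (x∙yz≈y∙xz)

  F : Label → FPS
  F l n = + descendants n l

  Σ-pos : ∀ ls n → Σ[ F ] ls n ≡ + sum (map (descendants n) ls)
  Σ-pos []       n = const-0 n
  Σ-pos (l ∷ ls) n = ≡.trans (cong (_+_ (F l n)) (Σ-pos ls n)) (≡.sym (pos-+ (descendants n l) _))

  F-solves : Solves children (const (+ 1)) F
  F-solves l zero    = ≡.sym (cong (_+_ (+ 1)) (Z⊛-zero (Σ[ F ] (children l))))
  F-solves l (suc n) = ≡.sym (≡.trans (ℤ.+-identityˡ _) (≡.trans (Z⊛-suc (Σ[ F ] (children l)) n) (Σ-pos (children l) n)))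

  -- The Catalan series, obtained as the series of a subtree: a solution of C = 1 + Z C² exists
  -- because the tree provides it.
  C : FPS
  C = F (flat 0)

  flat-children : ℕ → List ℕ
  flat-children b = suc b ∷ map suc (upTo b)

  F-flat : Solves flat-children (const (+ 1)) (F ∘ flat)
  F-flat b = R.trans (F-solves (flat b)) (R.+-congˡ {const (+ 1)} (R.*-congˡ {Z} (R.+-congˡ {F (flat (suc b))} (R.reflexive
    (cong (foldr _⊕_ (const (+ 0))) (lemma (upTo b)))))))
    where
    lemma : ∀ js → map F (map (λ j → flat (suc j)) js) ≡ map (F ∘ flat) (map suc js)
    lemma js = ≡.trans (≡.sym (map-∘ js)) (map-∘ js)

  -- f_b ↦ f_{b+1} and f_b ↦ f_0 f_b turn the system for the series f_b of `flat` into the same system.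
  F-flat-suc : Solves flat-children C (F ∘ flat ∘ suc)
  F-flat-suc b = begin
    f₁₊ b ≈⟨ F-flat (suc b) ⟩
    const (+ 1) ⊕ Z ⊛ (f₁₊ (suc b) ⊕ (f₁₊ 0 ⊕ rest)) ≈⟨ R.+-congˡ {const (+ 1)} (R.*-congˡ {Z} (x∙yz≈y∙xz (f₁₊ (suc b)) (f₁₊ 0) rest)) ⟩
    const (+ 1) ⊕ Z ⊛ (f₁₊ 0 ⊕ (f₁₊ (suc b) ⊕ rest)) ≈⟨ R.+-congˡ {const (+ 1)} (R.distribˡ Z (f₁₊ 0) (f₁₊ (suc b) ⊕ rest)) ⟩
    const (+ 1) ⊕ (Z ⊛ f₁₊ 0 ⊕ Z ⊛ (f₁₊ (suc b) ⊕ rest)) ≈⟨ R.sym (R.+-assoc (const (+ 1)) (Z ⊛ f₁₊ 0) (Z ⊛ (f₁₊ (suc b) ⊕ rest))) ⟩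
    const (+ 1) ⊕ Z ⊛ f₁₊ 0 ⊕ Z ⊛ (f₁₊ (suc b) ⊕ rest)
      ≈⟨ R.+-cong (R.sym (R.trans (F-flat 0) (R.+-congˡ {const (+ 1)} (R.*-congˡ {Z} (R.+-identityʳ (f₁₊ 0))))))
           (R.*-congˡ {Z} (R.+-congˡ {f₁₊ (suc b)} (R.reflexive (cong (foldr _⊕_ (const (+ 0))) (lemma b))))) ⟩
    C ⊕ Z ⊛ Σ[ f₁₊ ] (flat-children b) ∎
    where
    open import Relation.Binary.Reasoning.Setoid R.setoid
    open import Algebra.Properties.CommutativeSemigroup R.+-commutativeSemigroup using (x∙yz≈y∙xz)
    f₁₊ : ℕ → FPS
    f₁₊ b = F (flat (suc b))
    rest : FPS
    rest = Σ[ F ∘ flat ] (map suc (applyUpTo suc b))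
    lemma : ∀ b → map (F ∘ flat) (map suc (applyUpTo suc b)) ≡ map (F ∘ flat ∘ suc) (map suc (upTo b))
    lemma b = ≡.trans (cong (λ l → map (F ∘ flat) (map suc l)) (≡.sym (map-upTo suc b)))
      (≡.sym (map-∘ (map suc (upTo b))))

  C-equation : C ≐ const (+ 1) ⊕ Z ⊛ (C ⊛ C)
  C-equation = R.trans (F-flat 0) (R.+-congˡ {const (+ 1)} (R.*-congˡ {Z} (R.trans (R.+-identityʳ (F (flat 1)))
    -- At b = 0 the two solutions with constant term C are C f_0 = C² and f_1.
    (R.sym (Solves-unique {ch = flat-children} {C} {λ b → C ⊛ F (flat b)} C*-solves F-flat-suc 0)))))
    where
    C*-solves : Solves flat-children C (λ b → C ⊛ F (flat b))
    C*-solves b = R.trans (Solves-scale flat-children (const (+ 1)) (F ∘ flat) C F-flat b) (R.+-congʳ {Z ⊛ Σ[ (λ b → C ⊛ F (flat b)) ] (flat-children b)} (R.*-identityʳ C))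

  L : FPS
  L n = + (2 ℕ.^ n)

  L-equation : L ≐ const (+ 1) ⊕ Z ⊛ (const (+ 2) ⊛ L)
  L-equation zero    = ≡.sym (cong (_+_ (+ 1)) (Z⊛-zero (const (+ 2) ⊛ L)))
  L-equation (suc n) = ≡.sym (≡.trans (ℤ.+-identityˡ _) (≡.trans (Z⊛-suc (const (+ 2) ⊛ L) n) (≡.trans (const-⊛ (+ 2) L n) (≡.sym (ℤ.pos-* 2 (2 ℕ.^ n))))))

  open ClosedForm.Solution ring const-homomorphism Z C L C-equation L-equation

  -- Multiplying the counting system by D puts D in place of the constant term 1, and that is the
  -- system which `G` satisfies.
  F-closed : at₁ Poly.D ⊛ F (top₁ 0 0) ≐ G (top₁ 0 0)
  F-closed = Solves-unique {ch = children} {at₁ Poly.D} {λ l → at₁ Poly.D ⊛ F l} {G} D*-solves (λ l → R.sym (G-children l)) (top₁ 0 0)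
    where
    D*-solves : Solves children (at₁ Poly.D) (λ l → at₁ Poly.D ⊛ F l)
    D*-solves l = R.trans (Solves-scale children (const (+ 1)) F (at₁ Poly.D) F-solves l) (R.+-congʳ {Z ⊛ Σ[ (λ l → at₁ Poly.D ⊛ F l) ] (children l)} (R.*-identityʳ (at₁ Poly.D)))

  poly-horner : ∀ as → poly as ≐ horner as
  poly-horner []       n       = ≡.sym (const-0 n)
  poly-horner (a ∷ as) zero    = ≡.sym (≡.trans (cong (_+_ a) (Z⊛-zero (horner as))) (ℤ.+-identityʳ a))
  poly-horner (a ∷ as) (suc n) = ≡.sym (≡.trans (ℤ.+-identityˡ _) (≡.trans (Z⊛-suc (horner as) n) (≡.sym (poly-horner as n))))

  -- The lowest coefficient of the product is d 0 * e 0, so d 0 vanishes; then the tail of d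
  -- satisfies the same equation.
  zero-divisor : ∀ {d e} → ¬ e 0 ≡ + 0 → d ⊛ e ≐ const (+ 0) → ∀ n → d n ≡ + 0
  zero-divisor {d} {e} e≢0 de≐0 = go d (λ n → ≡.trans (≡.sym (⊛-conv d e n)) (≡.trans (de≐0 n) (const-0 n)))
    where
    go : ∀ d → (∀ n → conv d e n ≡ + 0) → ∀ n → d n ≡ + 0
    go d h n with ℤ.i*j≡0⇒i≡0∨j≡0 (d 0) (h 0)
    ... | inj₂ e≡0 = contradiction e≡0 e≢0
    go d h zero    | inj₁ d≡0 = d≡0
    go d h (suc n) | inj₁ d≡0 = go (tail d) (λ m → ≡.trans (≡.sym (≡.trans
      (cong (λ c → c * e (suc m) + conv (tail d) e m) d≡0) (ℤ.+-identityˡ _))) (h (suc m))) n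

  -- (s - t)(s + t) vanishes, and s + t has constant coefficient 2.
  sqrt-unique : ∀ {s t} → s 0 ≡ + 1 → t 0 ≡ + 1 → s ⊛ s ≐ t ⊛ t → s ≐ t
  sqrt-unique {s} {t} s0 t0 ss≐tt n = ℤ.i-j≡0⇒i≡j (s n) (t n)
    (zero-divisor {s ⊕ negate t} {s ⊕ t} (λ e → contradiction (≡.trans (≡.sym (cong₂ _+_ s0 t0)) e) λ ())
      (R.trans difference-of-squares (R.trans (R.+-congʳ ss≐tt) (R.-‿inverseʳ (t ⊛ t)))) n)
    where
    open import Algebra.Properties.Ring R.ring using (-‿distribˡ-*)
    open import Relation.Binary.Reasoning.Setoid R.setoid
    difference-of-squares : (s ⊕ negate t) ⊛ (s ⊕ t) ≐ s ⊛ s ⊕ negate (t ⊛ t)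
    difference-of-squares = begin
      (s ⊕ negate t) ⊛ (s ⊕ t) ≈⟨ R.distribˡ (s ⊕ negate t) s t ⟩
      (s ⊕ negate t) ⊛ s ⊕ (s ⊕ negate t) ⊛ t ≈⟨ R.+-cong (R.distribʳ s s (negate t)) (R.distribʳ t s (negate t)) ⟩
      s ⊛ s ⊕ negate t ⊛ s ⊕ (s ⊛ t ⊕ negate t ⊛ t)
        ≈⟨ R.+-cong (R.+-congˡ {s ⊛ s} (R.trans (R.sym (-‿distribˡ-* t s)) (R.-‿cong (R.*-comm t s))))
             (R.+-congˡ {s ⊛ t} (R.sym (-‿distribˡ-* t t))) ⟩
      s ⊛ s ⊕ negate (s ⊛ t) ⊕ (s ⊛ t ⊕ negate (t ⊛ t)) ≈⟨ R.+-assoc (s ⊛ s) (negate (s ⊛ t)) (s ⊛ t ⊕ negate (t ⊛ t)) ⟩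
      s ⊛ s ⊕ (negate (s ⊛ t) ⊕ (s ⊛ t ⊕ negate (t ⊛ t))) ≈⟨ R.+-congˡ {s ⊛ s} (R.sym (R.+-assoc (negate (s ⊛ t)) (s ⊛ t) (negate (t ⊛ t)))) ⟩
      s ⊛ s ⊕ (negate (s ⊛ t) ⊕ s ⊛ t ⊕ negate (t ⊛ t)) ≈⟨ R.+-congˡ {s ⊛ s} (R.+-congʳ {negate (t ⊛ t)} (R.-‿inverseˡ (s ⊛ t))) ⟩
      s ⊛ s ⊕ (const (+ 0) ⊕ negate (t ⊛ t)) ≈⟨ R.+-congˡ {s ⊛ s} (R.+-identityˡ (negate (t ⊛ t))) ⟩
      s ⊛ s ⊕ negate (t ⊛ t) ∎

  sqrt-0 : sqrt 0 ≡ + 1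
  sqrt-0 = cong (_+ -[1+ 0 ]) (≡.trans (⊛-zero (const (+ 2)) K) (cong (λ x → + 2 * (+ 1 + - x)) (Z⊛-zero C)))

  generating-function : (a : ℕ → ℕ) → a 0 ≡ 1 → (∀ n → a (suc n) ≡ descendants n (top₁ 0 0)) →
    ∀ (s : FPS) → IsSqrt1m4z s →
      poly (+ 2 ∷ []) ⊛ s ⊛ poly (+ 1 ∷ - + 3 ∷ + 1 ∷ []) ⊛ poly (+ 1 ∷ - + 3 ∷ + 1 ∷ []) ⊛ (λ n → + a n)
        ≐ poly (+ 2 ∷ - + 13 ∷ + 26 ∷ - + 17 ∷ + 4 ∷ [])
          ⊖ poly (+ 0 ∷ + 1 ∷ - + 2 ∷ - + 1 ∷ []) ⊛ s
  generating-function a a-zero a-suc s (s0 , s²) = begin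
    poly (+ 2 ∷ []) ⊛ s ⊛ q₀ ⊛ q₀ ⊛ P
      ≈⟨ R.*-congʳ {P} (R.*-cong (R.*-cong (R.*-cong (poly-horner (+ 2 ∷ [])) s≐) (poly-horner qs)) (poly-horner qs)) ⟩
    horner (+ 2 ∷ []) ⊛ sqrt ⊛ horner qs ⊛ horner qs ⊛ P ≈⟨ closed-form {F (top₁ 0 0)} {P} F-closed P≐ ⟩
    horner num ⊕ negate (horner den ⊛ sqrt)
      ≈⟨ R.sym (R.+-cong (poly-horner num) (R.-‿cong (R.*-cong (poly-horner den) s≐))) ⟩
    poly num ⊖ poly den ⊛ s ∎
    where
    open import Relation.Binary.Reasoning.Setoid R.setoid
    qs num den : List ℤ
    qs  = + 1 ∷ - + 3 ∷ + 1 ∷ []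
    num = + 2 ∷ - + 13 ∷ + 26 ∷ - + 17 ∷ + 4 ∷ []
    den = + 0 ∷ + 1 ∷ - + 2 ∷ - + 1 ∷ []
    q₀ P : FPS
    q₀ = poly qs
    P n = + a n
    P≐ : P ≐ const (+ 1) ⊕ Z ⊛ F (top₁ 0 0)
    P≐ zero    = ≡.trans (cong +_ a-zero) (≡.sym (cong (_+_ (+ 1)) (Z⊛-zero (F (top₁ 0 0)))))
    P≐ (suc n) = ≡.trans (cong +_ (a-suc n)) (≡.sym (≡.trans (ℤ.+-identityˡ _) (Z⊛-suc (F (top₁ 0 0)) n)))
    s≐ : s ≐ sqrt
    s≐ = sqrt-unique s0 sqrt-0 (R.trans s² (R.trans (poly-horner (+ 1 ∷ - + 4 ∷ [])) (R.sym sqrt²)))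

-- Appending an entry: active gaps and separation.

module Insertion where

  open import Data.Empty using (⊥)
  open import Data.List using ([_])
  open import Data.List.Membership.Propositional using (_∈_)
  open import Data.List.Membership.Propositional.Properties using (∈-upTo⁺; ∈-upTo⁻; ∈-map⁻)
  open import Data.List.Properties using (length-map; map-∘; map-id; map-cong; map-injective)
  open import Data.List.Relation.Binary.Permutation.Propositional using (_↭_; ↭-refl; ↭-sym; ↭-trans; prep; swap)
  open import Data.List.Relation.Binary.Permutation.Propositional.Properties using (∈-resp-↭; drop-∷; ↭-length) renaming (map⁺ to ↭-map⁺)
  open import Data.List.Relation.Binary.Sublist.Propositional using (_⊆_; []; _∷_; _∷ʳ_; minimum)
  open import Data.List.Relation.Binary.Sublist.Propositional.Properties using () renaming (map⁺ to ⊆-map⁺)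
  open import Data.List.Relation.Unary.Any using (here; there)
  open import Data.Nat
  open import Data.Nat.Properties
  open import Function.Base using (_∘_)
  open import Relation.Binary.PropositionalEquality hiding ([_])
  open import Relation.Nullary using (¬_)

  -- The new name of the value v once x has been inserted: values from x on move up by one.
  bump : ℕ → ℕ → ℕ
  bump zero    v       = suc v
  bump (suc x) zero    = zero
  bump (suc x) (suc v) = suc (bump x v)

  unbump : ℕ → ℕ → ℕ
  unbump x       zero    = zero
  unbump zero    (suc v) = v
  unbump (suc x) (suc v) = suc (unbump x v)

  unbump-bump : ∀ x v → unbump x (bump x v) ≡ v
  unbump-bump zero    v       = refl
  unbump-bump (suc x) zero    = refl
  unbump-bump (suc x) (suc v) = cong suc (unbump-bump x v)

  bump-injective : ∀ x {v w} → bump x v ≡ bump x w → v ≡ w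
  bump-injective x {v} {w} e = trans (sym (unbump-bump x v)) (trans (cong (unbump x) e) (unbump-bump x w))

  bump-mono-< : ∀ x {v w} → v < w → bump x v < bump x w
  bump-mono-< zero                v<w = s<s v<w
  bump-mono-< (suc x) {zero}  {suc w} v<w = z<s
  bump-mono-< (suc x) {suc v} {suc w} v<w = s<s (bump-mono-< x (s<s⁻¹ v<w))

  bump-cancel-< : ∀ x {v w} → bump x v < bump x w → v < w
  bump-cancel-< zero                    lt = s<s⁻¹ lt
  bump-cancel-< (suc x) {zero}  {suc w} lt = z<s
  bump-cancel-< (suc x) {suc v} {suc w} lt = s<s (bump-cancel-< x (s<s⁻¹ lt))

  module _ {x : ℕ} where
    -- This lemma and the seven after it say that a renamed value stays on its side of a gap. A gap
    -- g ≤ x keeps its number and a gap h ≥ x becomes h + 1; the gap x itself turns into two gaps, x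
    -- and x + 1.
    bump-<⁺ : ∀ {v g} → g ≤ x → v < g → bump x v < g
    bump-<⁺ {v} {g} = go x v g
      where
      go : ∀ x v g → g ≤ x → v < g → bump x v < g
      go (suc x) zero    (suc g) _ _ = z<s
      go (suc x) (suc v) (suc g) p q = s<s (go x v g (s≤s⁻¹ p) (s<s⁻¹ q))

    bump-<⁻ : ∀ {v g} → g ≤ x → bump x v < g → v < g
    bump-<⁻ {v} {g} = go x v g
      where
      go : ∀ x v g → g ≤ x → bump x v < g → v < g
      go (suc x) zero    (suc g) _ _ = z<s
      go (suc x) (suc v) (suc g) p q = s<s (go x v g (s≤s⁻¹ p) (s<s⁻¹ q))

    bump-<suc⁺ : ∀ {v h} → x ≤ h → v < h → bump x v < suc h
    bump-<suc⁺ {v} {h} = go x v h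
      where
      go : ∀ x v h → x ≤ h → v < h → bump x v < suc h
      go zero    v       h       _ q = s<s q
      go (suc x) zero    h       _ _ = z<s
      go (suc x) (suc v) (suc h) p q = s<s (go x v h (s≤s⁻¹ p) (s<s⁻¹ q))

    bump-<suc⁻ : ∀ {v h} → x ≤ h → bump x v < suc h → v < h
    bump-<suc⁻ {v} {h} = go x v h
      where
      go : ∀ x v h → x ≤ h → bump x v < suc h → v < h
      go zero    v       h       _ q = s<s⁻¹ q
      go (suc x) zero    (suc h) _ _ = z<s
      go (suc x) (suc v) (suc h) p q = s<s (go x v h (s≤s⁻¹ p) (s<s⁻¹ q))

    bump-≤⁺ : ∀ {v g} → g ≤ x → g ≤ v → g ≤ bump x v
    bump-≤⁺ g≤x g≤v = ≮⇒≥ (λ lt → ≤⇒≯ g≤v (bump-<⁻ g≤x lt))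

    bump-≤⁻ : ∀ {v g} → g ≤ x → g ≤ bump x v → g ≤ v
    bump-≤⁻ g≤x le = ≮⇒≥ (λ lt → ≤⇒≯ le (bump-<⁺ g≤x lt))

    bump-suc≤⁺ : ∀ {v h} → x ≤ h → h ≤ v → suc h ≤ bump x v
    bump-suc≤⁺ x≤h h≤v = ≮⇒≥ (λ lt → ≤⇒≯ h≤v (bump-<suc⁻ x≤h lt))

    bump-suc≤⁻ : ∀ {v h} → x ≤ h → suc h ≤ bump x v → h ≤ v
    bump-suc≤⁻ x≤h le = ≮⇒≥ (λ lt → ≤⇒≯ le (bump-<suc⁺ x≤h lt))

  -- Words are read from right to left, so appending a last entry is consing.
  insert : ℕ → List ℕ → List ℕ
  insert x ρ = x ∷ map (bump x) ρ

  insert-injective : ∀ {x y ρ τ} → insert x ρ ≡ insert y τ → x ≡ y × ρ ≡ τ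
  insert-injective {x} {ρ = ρ} {τ} e with cong Data.List.head e | cong (Data.List.drop 1) e
    where import Data.List
  ... | refl | e′ = refl , map-injective (bump-injective x) e′

  upTo-insert : ∀ {x n} → x ≤ n → upTo (suc n) ↭ insert x (upTo n)
  upTo-insert {zero}  {n}     _   = subst (λ l → upTo (suc n) ↭ zero ∷ l) (sym (map-upTo suc n)) ↭-refl
    where open import Data.List.Properties using (map-upTo)
  upTo-insert {suc x} {suc n} x≤n = subst₂ _↭_ (cong (0 ∷_) (map-upTo suc (suc n))) shape
    (↭-trans (prep 0 (↭-map⁺ suc (upTo-insert (s≤s⁻¹ x≤n)))) (swap 0 (suc x) ↭-refl))
    where
    open import Data.List.Properties using (map-upTo)
    shape : suc x ∷ 0 ∷ map suc (map (bump x) (upTo n)) ≡ insert (suc x) (upTo (suc n))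
    shape = cong (λ l → suc x ∷ 0 ∷ l) (trans (sym (map-∘ (upTo n)))
      (trans (map-∘ (upTo n)) (cong (map (bump (suc x))) (map-upTo suc n))))

  IsPerm-insert : ∀ {x n ρ} → x ≤ n → IsPerm n ρ → IsPerm (suc n) (insert x ρ)
  IsPerm-insert {x} x≤n p = ↭-trans (prep x (↭-map⁺ (bump x) p)) (↭-sym (upTo-insert x≤n))

  IsPerm-insert⁻ : ∀ {n σ} → IsPerm (suc n) σ → Σ ℕ λ x → Σ (List ℕ) λ ρ → σ ≡ insert x ρ × x ≤ n × IsPerm n ρ
  IsPerm-insert⁻ {n} {[]} p with () ← ↭-length p
  IsPerm-insert⁻ {n} {x ∷ τ} p = x , map (unbump x) τ , cong (x ∷_) (sym (τ≡ τ τ-bumped)) , x≤n , unbumped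
    where
    x≤n : x ≤ n
    x≤n = s≤s⁻¹ (∈-upTo⁻ (∈-resp-↭ p (here refl)))
    τ↭ : τ ↭ map (bump x) (upTo n)
    τ↭ = drop-∷ (↭-trans p (upTo-insert x≤n))
    unbumped : map (unbump x) τ ↭ upTo n
    unbumped = subst (map (unbump x) τ ↭_)
      (trans (sym (map-∘ (upTo n))) (trans (map-cong (unbump-bump x) (upTo n)) (map-id (upTo n)))) (↭-map⁺ (unbump x) τ↭)
    -- τ is a rearrangement of renamed values, so x is not among its entries and renaming can be
    -- undone.
    τ-bumped : ∀ {v} → v ∈ τ → bump x (unbump x v) ≡ v
    τ-bumped v∈τ with ∈-map⁻ (bump x) (∈-resp-↭ τ↭ v∈τ)
    ... | w , _ , refl = cong (bump x) (unbump-bump x w)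
    τ≡ : ∀ τ → (∀ {v} → v ∈ τ → bump x (unbump x v) ≡ v) → map (bump x) (map (unbump x) τ) ≡ τ
    τ≡ []      h = refl
    τ≡ (v ∷ τ) h = cong₂ _∷_ (h (here refl)) (τ≡ τ (h ∘ there))

  ⊆-map⁻ : ∀ (f : ℕ → ℕ) {ys} xs → ys ⊆ map f xs → ∃ λ zs → zs ⊆ xs × ys ≡ map f zs
  ⊆-map⁻ f []       []         = [] , [] , refl
  ⊆-map⁻ f (x ∷ xs) (_ ∷ʳ s)   with zs , s′ , refl ← ⊆-map⁻ f xs s = zs , x ∷ʳ s′ , refl
  ⊆-map⁻ f (x ∷ xs) (refl ∷ s) with zs , s′ , refl ← ⊆-map⁻ f xs s = x ∷ zs , refl ∷ s′ , refl

  ∈⇒⊆ : ∀ {v : ℕ} {ρ} → v ∈ ρ → [ v ] ⊆ ρ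
  ∈⇒⊆ (here refl) = refl ∷ minimum _
  ∈⇒⊆ (there v∈ρ) = _ ∷ʳ ∈⇒⊆ v∈ρ

  ⊆⇒∈ : ∀ {v : ℕ} {ρ} → [ v ] ⊆ ρ → v ∈ ρ
  ⊆⇒∈ (_ ∷ʳ s)   = there (⊆⇒∈ s)
  ⊆⇒∈ (refl ∷ _) = here refl

  -- The gap g lies between the values g − 1 and g.  It is active when a last entry inserted there
  -- plays neither the 4 of 1324 nor the 3 of 4123 (reversed: 4231 and 3214).
  record Active (ρ : List ℕ) (g : ℕ) : Set where
    field
      bounded : g ≤ length ρ
      no-231  : ∀ {a b c} → a ∷ b ∷ c ∷ [] ⊆ ρ → c < a → a < b → b < g → ⊥
      no-214  : ∀ {a b c} → a ∷ b ∷ c ∷ [] ⊆ ρ → b < a → a < g → g ≤ c → ⊥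
  open Active public

  record Avoiding (ρ : List ℕ) : Set where
    field
      no-4231 : ∀ {a b c d} → a ∷ b ∷ c ∷ d ∷ [] ⊆ ρ → d < b → b < c → c < a → ⊥
      no-3214 : ∀ {a b c d} → a ∷ b ∷ c ∷ d ∷ [] ⊆ ρ → c < b → b < a → a < d → ⊥
  open Avoiding public

  -- After x has been inserted, the gap h ≥ x stays active exactly when, among the entries of ρ,
  -- no value in [x , h) precedes a value below x, and no value below x precedes a value ≥ h.
  record Sep (ρ : List ℕ) (x h : ℕ) : Set where
    field
      no-fall : ∀ {p q} → p ∷ q ∷ [] ⊆ ρ → x ≤ p → p < h → q < x → ⊥
      no-rise : ∀ {p q} → p ∷ q ∷ [] ⊆ ρ → p < x → h ≤ q → ⊥
  open Sep public

  private
    lift : ∀ {x ρ ys} → ys ⊆ ρ → map (bump x) ys ⊆ insert x ρ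
    lift {x} s = x ∷ʳ ⊆-map⁺ (bump x) s

    lift-∷ : ∀ {x ρ ys} → ys ⊆ ρ → x ∷ map (bump x) ys ⊆ insert x ρ
    lift-∷ {x} s = refl ∷ ⊆-map⁺ (bump x) s

  -- The new entry is the first letter of the word, hence it can only be the first letter of a
  -- subsequence.
  data Insert₂ (x : ℕ) (ρ : List ℕ) : ℕ → ℕ → Set where
    skip : ∀ {a b} → a ∷ b ∷ [] ⊆ ρ → Insert₂ x ρ (bump x a) (bump x b)
    take : ∀ {b} → b ∈ ρ → Insert₂ x ρ x (bump x b)

  data Insert₃ (x : ℕ) (ρ : List ℕ) : ℕ → ℕ → ℕ → Set where
    skip : ∀ {a b c} → a ∷ b ∷ c ∷ [] ⊆ ρ → Insert₃ x ρ (bump x a) (bump x b) (bump x c)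
    take : ∀ {b c} → b ∷ c ∷ [] ⊆ ρ → Insert₃ x ρ x (bump x b) (bump x c)

  data Insert₄ (x : ℕ) (ρ : List ℕ) : ℕ → ℕ → ℕ → ℕ → Set where
    skip : ∀ {a b c d} → a ∷ b ∷ c ∷ d ∷ [] ⊆ ρ → Insert₄ x ρ (bump x a) (bump x b) (bump x c) (bump x d)
    take : ∀ {b c d} → b ∷ c ∷ d ∷ [] ⊆ ρ → Insert₄ x ρ x (bump x b) (bump x c) (bump x d)

  insert₂ : ∀ {x ρ a b} → a ∷ b ∷ [] ⊆ insert x ρ → Insert₂ x ρ a b
  insert₂ {x} {ρ} (_ ∷ʳ s)   with _ ∷ _ ∷ [] , s′ , refl ← ⊆-map⁻ (bump x) ρ s = skip s′
  insert₂ {x} {ρ} (refl ∷ s) with _ ∷ [] , s′ , refl ← ⊆-map⁻ (bump x) ρ s = take (⊆⇒∈ s′)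

  insert₃ : ∀ {x ρ a b c} → a ∷ b ∷ c ∷ [] ⊆ insert x ρ → Insert₃ x ρ a b c
  insert₃ {x} {ρ} (_ ∷ʳ s)   with _ ∷ _ ∷ _ ∷ [] , s′ , refl ← ⊆-map⁻ (bump x) ρ s = skip s′
  insert₃ {x} {ρ} (refl ∷ s) with _ ∷ _ ∷ [] , s′ , refl ← ⊆-map⁻ (bump x) ρ s = take s′

  insert₄ : ∀ {x ρ a b c d} → a ∷ b ∷ c ∷ d ∷ [] ⊆ insert x ρ → Insert₄ x ρ a b c d
  insert₄ {x} {ρ} (_ ∷ʳ s)   with _ ∷ _ ∷ _ ∷ _ ∷ [] , s′ , refl ← ⊆-map⁻ (bump x) ρ s = skip s′
  insert₄ {x} {ρ} (refl ∷ s) with _ ∷ _ ∷ _ ∷ [] , s′ , refl ← ⊆-map⁻ (bump x) ρ s = take s′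

  Active-0 : ∀ ρ → Active ρ 0
  Active-0 ρ = record { bounded = z≤n ; no-231 = λ { _ _ _ () } ; no-214 = λ { _ _ () _ } }

  length-insert : ∀ x ρ → length (insert x ρ) ≡ suc (length ρ)
  length-insert x ρ = cong suc (length-map (bump x) ρ)

  -- In both forbidden configurations the first letter lies below the gap, and x ≥ g does not.
  Active-below⁺ : ∀ {x ρ g} → g ≤ x → Active ρ g → Active (insert x ρ) g
  Active-below⁺ {x} {ρ} {g} g≤x A = record
    { bounded = ≤-trans (bounded A) (≤-trans (n≤1+n _) (≤-reflexive (sym (length-insert x ρ))))
    ; no-231  = λ s → f (insert₃ s)
    ; no-214  = λ s → f′ (insert₃ s)
    }
    where
    f : ∀ {a b c} → Insert₃ x ρ a b c → c < a → a < b → b < g → ⊥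
    f (skip s) c<a a<b b<g = no-231 A s (bump-cancel-< x c<a) (bump-cancel-< x a<b) (bump-<⁻ g≤x b<g)
    f (take s) c<a a<b b<g = <-irrefl refl (<-≤-trans (<-trans a<b b<g) g≤x)
    f′ : ∀ {a b c} → Insert₃ x ρ a b c → b < a → a < g → g ≤ c → ⊥
    f′ (skip s) b<a a<g g≤c = no-214 A s (bump-cancel-< x b<a) (bump-<⁻ g≤x a<g) (bump-≤⁻ g≤x g≤c)
    f′ (take s) b<a a<g g≤c = <-irrefl refl (<-≤-trans a<g g≤x)

  Active-below⁻ : ∀ {x ρ g} → x ≤ length ρ → g ≤ x → Active (insert x ρ) g → Active ρ g
  Active-below⁻ {x} x≤n g≤x A = record
    { bounded = ≤-trans g≤x x≤n
    ; no-231  = λ s c<a a<b b<g → no-231 A (lift s) (bump-mono-< x c<a) (bump-mono-< x a<b) (bump-<⁺ g≤x b<g)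
    ; no-214  = λ s b<a a<g g≤c → no-214 A (lift s) (bump-mono-< x b<a) (bump-<⁺ g≤x a<g) (bump-≤⁺ g≤x g≤c)
    }

  -- If x is the first letter of a forbidden configuration, the other two letters form a fall (for
  -- 231) or a rise (for 214) across x.
  Active-above⁺ : ∀ {x ρ h} → x ≤ h → Active ρ h → Sep ρ x h → Active (insert x ρ) (suc h)
  Active-above⁺ {x} {ρ} {h} x≤h A S = record
    { bounded = ≤-trans (s≤s (bounded A)) (≤-reflexive (sym (length-insert x ρ)))
    ; no-231  = λ s → f (insert₃ s)
    ; no-214  = λ s → f′ (insert₃ s)
    }
    where
    f : ∀ {a b c} → Insert₃ x ρ a b c → c < a → a < b → b < suc h → ⊥
    f (skip s) c<a a<b b<g = no-231 A s (bump-cancel-< x c<a) (bump-cancel-< x a<b) (bump-<suc⁻ x≤h b<g)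
    f (take s) c<a a<b b<g = no-fall S s (bump-suc≤⁻ ≤-refl a<b) (bump-<suc⁻ x≤h b<g) (bump-<⁻ ≤-refl c<a)
    f′ : ∀ {a b c} → Insert₃ x ρ a b c → b < a → a < suc h → suc h ≤ c → ⊥
    f′ (skip s) b<a a<g g≤c = no-214 A s (bump-cancel-< x b<a) (bump-<suc⁻ x≤h a<g) (bump-suc≤⁻ x≤h g≤c)
    f′ (take s) b<a a<g g≤c = no-rise S s (bump-<⁻ ≤-refl b<a) (bump-suc≤⁻ x≤h g≤c)

  Active-above⁻ : ∀ {x ρ h} → x ≤ h → Active (insert x ρ) (suc h) → Active ρ h × Sep ρ x h
  Active-above⁻ {x} {ρ} x≤h A = record
    { bounded = s≤s⁻¹ (≤-trans (bounded A) (≤-reflexive (length-insert x ρ)))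
    ; no-231  = λ s c<a a<b b<g → no-231 A (lift s) (bump-mono-< x c<a) (bump-mono-< x a<b) (bump-<suc⁺ x≤h b<g)
    ; no-214  = λ s b<a a<g g≤c → no-214 A (lift s) (bump-mono-< x b<a) (bump-<suc⁺ x≤h a<g) (bump-suc≤⁺ x≤h g≤c)
    } , record
    { no-fall = λ s x≤p p<h q<x → no-231 A (lift-∷ s) (bump-<⁺ ≤-refl q<x) (bump-suc≤⁺ ≤-refl x≤p) (bump-<suc⁺ x≤h p<h)
    ; no-rise = λ s p<x h≤q → no-214 A (lift-∷ s) (bump-<⁺ ≤-refl p<x) (s≤s x≤h) (bump-suc≤⁺ x≤h h≤q)
    }

  -- No value is below 0. So an entry inserted at 0 leaves every active gap active, in contrast to
  -- all other insertions.
  Sep-0 : ∀ ρ h → Sep ρ 0 h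
  Sep-0 ρ h = record { no-fall = λ { _ _ _ () } ; no-rise = λ { _ () _ } }

  Sep-below⁺ : ∀ {x ρ g k} → g ≤ x → k ≤ x → Sep ρ g k → Sep (insert x ρ) g k
  Sep-below⁺ {x} {ρ} {g} {k} g≤x k≤x S = record { no-fall = λ s → f (insert₂ s) ; no-rise = λ s → f′ (insert₂ s) }
    where
    f : ∀ {p q} → Insert₂ x ρ p q → g ≤ p → p < k → q < g → ⊥
    f (skip s) g≤p p<k q<g = no-fall S s (bump-≤⁻ g≤x g≤p) (bump-<⁻ k≤x p<k) (bump-<⁻ g≤x q<g)
    f (take s) g≤p p<k q<g = <-irrefl refl (<-≤-trans p<k k≤x)
    f′ : ∀ {p q} → Insert₂ x ρ p q → p < g → k ≤ q → ⊥
    f′ (skip s) p<g k≤q = no-rise S s (bump-<⁻ g≤x p<g) (bump-≤⁻ k≤x k≤q)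
    f′ (take s) p<g k≤q = <-irrefl refl (<-≤-trans p<g g≤x)

  Sep-below⁻ : ∀ {x ρ g k} → g ≤ x → k ≤ x → Sep (insert x ρ) g k → Sep ρ g k
  Sep-below⁻ {x} g≤x k≤x S = record
    { no-fall = λ s g≤p p<k q<g → no-fall S (lift s) (bump-≤⁺ g≤x g≤p) (bump-<⁺ k≤x p<k) (bump-<⁺ g≤x q<g)
    ; no-rise = λ s p<g k≤q → no-rise S (lift s) (bump-<⁺ g≤x p<g) (bump-≤⁺ k≤x k≤q)
    }

  ∈-length : ∀ {ρ v} → IsPerm (length ρ) ρ → v ∈ ρ → v < length ρ
  ∈-length P v∈ρ = ∈-upTo⁻ (∈-resp-↭ P v∈ρ)

  length-∈ : ∀ {ρ v} → IsPerm (length ρ) ρ → v < length ρ → v ∈ ρ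
  length-∈ P v<n = ∈-resp-↭ (↭-sym P) (∈-upTo⁺ v<n)

  -- The new first letter x lies in [g , k) and precedes the value 0, which is below g: a fall.
  ¬Sep-across : ∀ {x ρ g k} → IsPerm (length ρ) ρ → x ≤ length ρ → 0 < g → g ≤ x → x < k → ¬ Sep (insert x ρ) g k
  ¬Sep-across {x} P x≤n 0<g g≤x x<k S =
    no-fall S (lift-∷ (∈⇒⊆ (length-∈ P (<-≤-trans 0<g (≤-trans g≤x x≤n))))) g≤x x<k (bump-<⁺ g≤x 0<g)

  Sep-above⁺ : ∀ {x ρ g} → IsPerm (length ρ) ρ → x ≤ g → g ≤ length ρ → Sep ρ g (length ρ) → Sep (insert x ρ) (suc g) (suc (length ρ))
  Sep-above⁺ {x} {ρ} {g} P x≤g g≤n S = record { no-fall = λ s → f (insert₂ s) ; no-rise = λ s → f′ (insert₂ s) }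
    where
    f : ∀ {p q} → Insert₂ x ρ p q → suc g ≤ p → p < suc (length ρ) → q < suc g → ⊥
    f (skip s) g<p p<n q<g = no-fall S s (bump-suc≤⁻ x≤g g<p) (bump-<suc⁻ (≤-trans x≤g g≤n) p<n) (bump-<suc⁻ x≤g q<g)
    f (take s) g<p p<n q<g = <-irrefl refl (<-≤-trans g<p x≤g)
    f′ : ∀ {p q} → Insert₂ x ρ p q → p < suc g → suc (length ρ) ≤ q → ⊥
    f′ (skip s) p<g n≤q = no-rise S s (bump-<suc⁻ x≤g p<g) (bump-suc≤⁻ (≤-trans x≤g g≤n) n≤q)
    f′ (take q∈ρ) p<g n≤q = ≤⇒≯ (bump-suc≤⁻ (≤-trans x≤g g≤n) n≤q) (∈-length P q∈ρ)

  -- The first letter x is below suc g, so any value from suc k on would complete a rise. Hence suc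
  -- k is at or beyond the top.
  Sep-above⁻ : ∀ {x ρ g k} → IsPerm (length ρ) ρ → x ≤ g → g ≤ k → Sep (insert x ρ) (suc g) (suc k) → length ρ ≤ k × Sep ρ g k
  Sep-above⁻ {x} {ρ} {g} {k} P x≤g g≤k S = ≮⇒≥ (λ k<n → no-rise S (lift-∷ (∈⇒⊆ (length-∈ P k<n))) (s≤s x≤g) (bump-suc≤⁺ x≤k ≤-refl))
    , record
    { no-fall = λ s g≤p p<k q<g → no-fall S (lift s) (bump-suc≤⁺ x≤g g≤p) (bump-<suc⁺ x≤k p<k) (bump-<suc⁺ x≤g q<g)
    ; no-rise = λ s p<g k≤q → no-rise S (lift s) (bump-<suc⁺ x≤g p<g) (bump-suc≤⁺ x≤k k≤q)
    }
    where
    x≤k : x ≤ k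
    x≤k = ≤-trans x≤g g≤k

  Sep-top : ∀ {ρ} → IsPerm (length ρ) ρ → Sep ρ (length ρ) (length ρ)
  Sep-top {ρ} P = record
    { no-fall = λ _ n≤p p<n _ → <-irrefl refl (≤-<-trans n≤p p<n)
    ; no-rise = λ s _ n≤q → ≤⇒≯ n≤q (∈-length P (⊆⇒∈ (⊆-trans (_ ∷ʳ ⊆-refl) s)))
    }
    where open import Data.List.Relation.Binary.Sublist.Propositional using (⊆-trans; ⊆-refl)

  Avoiding-insert⁺ : ∀ {x ρ} → Avoiding ρ → Active ρ x → Avoiding (insert x ρ)
  Avoiding-insert⁺ {x} {ρ} V A = record { no-4231 = λ s → f (insert₄ s) ; no-3214 = λ s → f′ (insert₄ s) }
    where
    f : ∀ {a b c d} → Insert₄ x ρ a b c d → d < b → b < c → c < a → ⊥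
    f (skip s) d<b b<c c<a = no-4231 V s (bump-cancel-< x d<b) (bump-cancel-< x b<c) (bump-cancel-< x c<a)
    f (take s) d<b b<c c<a = no-231 A s (bump-cancel-< x d<b) (bump-cancel-< x b<c) (bump-<⁻ ≤-refl c<a)
    f′ : ∀ {a b c d} → Insert₄ x ρ a b c d → c < b → b < a → a < d → ⊥
    f′ (skip s) c<b b<a a<d = no-3214 V s (bump-cancel-< x c<b) (bump-cancel-< x b<a) (bump-cancel-< x a<d)
    f′ (take s) c<b b<a a<d = no-214 A s (bump-cancel-< x c<b) (bump-<⁻ ≤-refl b<a) (bump-suc≤⁻ ≤-refl a<d)

  Avoiding-insert⁻ : ∀ {x ρ} → x ≤ length ρ → Avoiding (insert x ρ) → Avoiding ρ × Active ρ x
  Avoiding-insert⁻ {x} x≤n V = record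
    { no-4231 = λ s d<b b<c c<a → no-4231 V (lift s) (bump-mono-< x d<b) (bump-mono-< x b<c) (bump-mono-< x c<a)
    ; no-3214 = λ s c<b b<a a<d → no-3214 V (lift s) (bump-mono-< x c<b) (bump-mono-< x b<a) (bump-mono-< x a<d)
    } , record
    { bounded = x≤n
    ; no-231  = λ s c<a a<b b<x → no-4231 V (lift-∷ s) (bump-mono-< x c<a) (bump-mono-< x a<b) (bump-<⁺ ≤-refl b<x)
    ; no-214  = λ s b<a a<x x≤c → no-3214 V (lift-∷ s) (bump-mono-< x b<a) (bump-<⁺ ≤-refl a<x) (bump-suc≤⁺ ≤-refl x≤c)
    }

-- How an insertion changes the active gaps and their survivors.

module State where

  open Insertion
  open import Data.List using ([_])
  open import Data.List.Membership.Propositional using (_∈_)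
  open import Data.List.Membership.Propositional.Properties using (∈-map⁺; ∈-map⁻; ∈-++⁺ˡ; ∈-++⁺ʳ; ∈-++⁻)
  open import Data.List.Relation.Unary.All as All using (All; []; _∷_)
  import Data.List.Relation.Unary.All.Properties as All
  open import Data.List.Relation.Unary.AllPairs as AllPairs using (AllPairs; []; _∷_)
  import Data.List.Relation.Unary.AllPairs.Properties as AllPairs
  open import Data.List.Relation.Unary.Any using (here; there)
  open import Data.Maybe using (Maybe; just; nothing)
  open import Data.Nat
  open import Data.Nat.Properties
  open import Data.Product using (proj₁; proj₂)
  open import Data.Sum using (inj₁; inj₂)
  open import Relation.Binary.PropositionalEquality hiding ([_])
  open import Relation.Nullary using (¬_; contradiction; yes; no)

  -- A positive active gap g, with the active gap k ≥ g such that Sep ρ g k, if there is one.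
  Entry : Set
  Entry = ℕ × Maybe ℕ

  _≺_ : Entry → Entry → Set
  e ≺ f = proj₁ e < proj₁ f

  -- By `unique`, `nothing` means that there is no survivor at all and `just k` that there is no
  -- other. The word is nonempty, so that its top gap is positive and is listed whenever it is
  -- active.
  record State (ρ : List ℕ) (es : List Entry) : Set where
    field
      perm     : IsPerm (length ρ) ρ
      avoiding : Avoiding ρ
      nonempty : 0 < length ρ
      sorted   : AllPairs _≺_ es
      sound    : ∀ {g t} → (g , t) ∈ es → 0 < g × Active ρ g
      complete : ∀ {g} → 0 < g → Active ρ g → ∃ λ t → (g , t) ∈ es
      target   : ∀ {g k} → (g , just k) ∈ es → g ≤ k × Active ρ k × Sep ρ g k
      unique   : ∀ {g t k} → (g , t) ∈ es → Active ρ k → g ≤ k → Sep ρ g k → t ≡ just k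
  open State public

  -- The fate of the survivor of a gap g ≤ x when x is inserted: by `¬Sep-across` it is lost if it
  -- lies above x.
  cut : ℕ → Maybe ℕ → Maybe ℕ
  cut x nothing  = nothing
  cut x (just k) with k ≤? x
  ... | yes _ = just k
  ... | no _  = nothing

  cut-just⁻ : ∀ x t {k} → cut x t ≡ just k → t ≡ just k × k ≤ x
  cut-just⁻ x (just k) e with k ≤? x
  cut-just⁻ x (just k) refl | yes k≤x = refl , k≤x

  cut-≤ : ∀ {x k} → k ≤ x → cut x (just k) ≡ just k
  cut-≤ {x} {k} k≤x with k ≤? x
  ... | yes _   = refl
  ... | no  k≰x = contradiction k≤x k≰x

  cut-> : ∀ {x k} → x < k → cut x (just k) ≡ nothing
  cut-> {x} {k} x<k with k ≤? x
  ... | yes k≤x = contradiction k≤x (<⇒≱ x<k)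
  ... | no  _   = refl

  -- The fate of the survivor of a gap above the new entry: by `Sep-above⁻` only the top gap n can
  -- remain one, and it becomes n + 1.
  raise : ℕ → Maybe ℕ → Maybe ℕ
  raise n nothing  = nothing
  raise n (just k) with k ≟ n
  ... | yes _ = just (suc n)
  ... | no _  = nothing

  raise-just⁻ : ∀ n t {k} → raise n t ≡ just k → t ≡ just n × k ≡ suc n
  raise-just⁻ n (just k) e with k ≟ n
  raise-just⁻ n (just k) refl | yes refl = refl , refl

  raise-top : ∀ n → raise n (just n) ≡ just (suc n)
  raise-top n with n ≟ n
  ... | yes _  = refl
  ... | no n≢n = contradiction refl n≢n

  raise-≢ : ∀ {n t} → t ≢ just n → raise n t ≡ nothing
  raise-≢ {n} {nothing} _ = refl
  raise-≢ {n} {just k} k≢n with k ≟ n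
  ... | yes refl = contradiction refl k≢n
  ... | no _     = refl

  cutEntry shift : ℕ → Entry → Entry
  cutEntry x (g , t) = g , cut x t
  shift n (g , t) = suc g , raise n t

  -- The survivor h of x is the only active gap left above x. Thus it can have no survivor but
  -- itself, and this only if it is the top gap; so `raise` is applied to h and not to the survivor
  -- of h.
  above : ℕ → Maybe ℕ → List Entry
  above n nothing  = []
  above n (just h) = [ suc h , raise n (just h) ]

  -- The survivor of the gap 1 after an insertion at 0: the new top gap, provided that the old one
  -- was active.
  data Top (ρ : List ℕ) : Maybe ℕ → Set where
    active   : Active ρ (length ρ) → Top ρ (just (suc (length ρ)))
    inactive : ¬ Active ρ (length ρ) → Top ρ nothing

  private
    AllPairs-split : ∀ {A : Set} {R : A → A → Set} xs {y ys} → AllPairs R (xs ++ y ∷ ys) →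
                     All (λ x → R x y) xs × All (R y) ys × AllPairs R xs
    AllPairs-split []       (y< ∷ _) = [] , y< , []
    AllPairs-split (x ∷ xs) (x< ∷ p) with xs< , y< , q ← AllPairs-split xs p =
      All.lookup x< (∈-++⁺ʳ xs (here refl)) ∷ xs< , y< , All.++⁻ˡ xs x< ∷ q

  State-sorted : ∀ {ρ pre e post} → State ρ (pre ++ e ∷ post) → All (_≺ e) pre × All (e ≺_) post
  State-sorted {pre = pre} st with xs , ys , _ ← AllPairs-split pre (sorted st) = xs , ys

  State-insert-0 : ∀ {ρ es t} → State ρ es → Top ρ t → State (insert 0 ρ) ((1 , t) ∷ map (shift (length ρ)) es)
  State-insert-0 {ρ} {es} {t} st top = record
    { perm     = subst (λ m → IsPerm m (insert 0 ρ)) (sym (length-insert 0 ρ)) (IsPerm-insert z≤n (perm st))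
    ; avoiding = Avoiding-insert⁺ (avoiding st) (Active-0 ρ)
    ; nonempty = s≤s z≤n
    ; sorted   = All.map⁺ (All.tabulate λ e∈ → s≤s (proj₁ (sound st e∈)))
                 ∷ AllPairs.map⁺ (AllPairs.map s≤s (sorted st))
    ; sound    = sound′
    ; complete = complete′
    ; target   = target′ top
    ; unique   = unique′ top
    }
    where
    n = length ρ
    sound′ : ∀ {g t′} → (g , t′) ∈ (1 , t) ∷ map (shift n) es → 0 < g × Active (insert 0 ρ) g
    sound′ (here refl) = z<s , Active-above⁺ z≤n (Active-0 ρ) (Sep-0 ρ 0)
    sound′ (there e∈) with (g , _) , e∈′ , refl ← ∈-map⁻ (shift n) e∈ = z<s , Active-above⁺ z≤n (proj₂ (sound st e∈′)) (Sep-0 ρ g)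
    complete′ : ∀ {g} → 0 < g → Active (insert 0 ρ) g → ∃ λ t′ → (g , t′) ∈ (1 , t) ∷ map (shift n) es
    complete′ {suc zero}    _ A = t , here refl
    complete′ {suc (suc g)} _ A with t′ , e∈ ← complete st z<s (proj₁ (Active-above⁻ z≤n A)) = raise n t′ , there (∈-map⁺ (shift n) e∈)
    top-active : Active ρ n → Active (insert 0 ρ) (suc n)
    top-active A = Active-above⁺ z≤n A (Sep-0 ρ n)
    shift-target : ∀ {g t′ k} → (g , t′) ∈ es → raise n t′ ≡ just k → suc g ≤ k × Active (insert 0 ρ) k × Sep (insert 0 ρ) (suc g) k
    shift-target {t′ = t′} e∈ eq with refl , refl ← raise-just⁻ n t′ eq with g≤n , A , S ← target st e∈ =
      s≤s g≤n , top-active A , Sep-above⁺ (perm st) z≤n g≤n S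
    target′ : ∀ {t} → Top ρ t → ∀ {g k} → (g , just k) ∈ (1 , t) ∷ map (shift n) es → g ≤ k × Active (insert 0 ρ) k × Sep (insert 0 ρ) g k
    target′ (active A) (here refl) = s≤s z≤n , top-active A , Sep-above⁺ (perm st) z≤n z≤n (Sep-0 ρ n)
    target′ top (there e∈) with (g , t′) , e∈′ , eq ← ∈-map⁻ (shift n) e∈ with refl ← cong proj₁ eq = shift-target e∈′ (sym (cong proj₂ eq))
    unique′ : ∀ {t} → Top ρ t → ∀ {g t′ k} → (g , t′) ∈ (1 , t) ∷ map (shift n) es → Active (insert 0 ρ) k → g ≤ k → Sep (insert 0 ρ) g k → t′ ≡ just k
    unique′ top {k = suc k} (here refl) A g≤k S with A′ , _ ← Active-above⁻ z≤n A | n≤k , _ ← Sep-above⁻ (perm st) z≤n (s≤s⁻¹ g≤k) S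
      with refl ← ≤-antisym n≤k (bounded A′) | top
    ... | active _    = refl
    ... | inactive ¬A = contradiction A′ ¬A
    unique′ top {k = suc k} (there e∈) A g≤k S with (g , t′) , e∈′ , refl ← ∈-map⁻ (shift n) e∈
      with A′ , _ ← Active-above⁻ z≤n A | n≤k , S′ ← Sep-above⁻ (perm st) z≤n (s≤s⁻¹ g≤k) S
      with refl ← ≤-antisym n≤k (bounded A′) | refl ← unique st e∈′ A′ (s≤s⁻¹ g≤k) S′ = raise-top n
    unique′ top {k = zero} (here refl) A () S
    unique′ top {k = zero} (there e∈) A g≤k S with (g , t′) , e∈′ , refl ← ∈-map⁻ (shift n) e∈ with () ← g≤k

  -- The entries of `post` disappear except for the survivor of x, which `above` restores under its
  -- new number. The gap x itself stays, as the gap just below the new entry.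
  State-insert : ∀ {ρ pre x t post} → State ρ (pre ++ (x , t) ∷ post) →
                 State (insert x ρ) (map (cutEntry x) (pre ++ [ x , t ]) ++ above (length ρ) t)
  State-insert {ρ} {pre} {x} {t} {post} st = record
    { perm     = subst (λ m → IsPerm m (insert x ρ)) (sym (length-insert x ρ)) (IsPerm-insert x≤n (perm st))
    ; avoiding = Avoiding-insert⁺ (avoiding st) Ax
    ; nonempty = s≤s z≤n
    ; sorted   = sorted′
    ; sound    = sound′
    ; complete = complete′
    ; target   = target′
    ; unique   = unique′
    }
    where
    n = length ρ
    es = pre ++ (x , t) ∷ post
    low = pre ++ [ x , t ]
    es′ = map (cutEntry x) low ++ above n t
    x∈ : (x , t) ∈ es
    x∈ = ∈-++⁺ʳ pre (here refl)
    0<x = proj₁ (sound st x∈)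
    Ax = proj₂ (sound st x∈)
    x≤n = bounded Ax
    low⊆ : ∀ {e} → e ∈ low → e ∈ es
    low⊆ e∈ with ∈-++⁻ pre e∈
    ... | inj₁ e∈pre      = ∈-++⁺ˡ e∈pre
    ... | inj₂ (here refl) = x∈
    low≤ : ∀ {g t′} → (g , t′) ∈ low → g ≤ x
    low≤ e∈ with ∈-++⁻ pre e∈
    ... | inj₁ e∈pre      = <⇒≤ (All.lookup (proj₁ (State-sorted st)) e∈pre)
    ... | inj₂ (here refl) = ≤-refl
    low-complete : ∀ {g t′} → (g , t′) ∈ es → g ≤ x → (g , t′) ∈ low
    low-complete e∈ g≤x with ∈-++⁻ pre e∈
    ... | inj₁ e∈pre             = ∈-++⁺ˡ e∈pre
    ... | inj₂ (here refl)       = ∈-++⁺ʳ pre (here refl)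
    ... | inj₂ (there e∈post)    = contradiction g≤x (<⇒≱ (All.lookup (proj₂ (State-sorted {pre = pre} st)) e∈post))

    data View : ℕ → Maybe ℕ → Set where
      old : ∀ {g t′} → (g , t′) ∈ low → View g (cut x t′)
      new : ∀ {h} → t ≡ just h → View (suc h) (raise n (just h))

    view-above : ∀ t′ {g t″} → t ≡ t′ → (g , t″) ∈ above n t′ → View g t″
    view-above (just h) eq (here refl) = new eq

    view : ∀ {g t′} → (g , t′) ∈ es′ → View g t′
    view e∈ with ∈-++⁻ (map (cutEntry x) low) e∈
    ... | inj₂ e∈above = view-above t refl e∈above
    ... | inj₁ e∈low with _ , e∈ , refl ← ∈-map⁻ (cutEntry x) e∈low = old e∈

    x-target : ∀ {h} → t ≡ just h → x ≤ h × Active ρ h × Sep ρ x h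
    x-target refl = target st x∈

    sorted-low : ∀ pre → AllPairs _≺_ pre → All (_≺ (x , t)) pre → AllPairs _≺_ (map (cutEntry x) (pre ++ [ x , t ]))
    sorted-low []        _        _         = [] ∷ []
    sorted-low (e ∷ pre) (p ∷ ps) (q ∷ qs) = All.map⁺ (All.++⁺ p (q ∷ [])) ∷ sorted-low pre ps qs

    sorted-above : ∀ t → AllPairs _≺_ (above n t)
    sorted-above nothing  = []
    sorted-above (just _) = [] ∷ []

    sorted′ : AllPairs _≺_ es′
    sorted′ with pre< , _ , pre-sorted ← AllPairs-split pre (sorted st) = AllPairs.++⁺ (sorted-low pre pre-sorted pre<) (sorted-above t)
      (All.tabulate λ e∈ → All.tabulate λ f∈ → crossing (∈-map⁻ (cutEntry x) e∈) (view-above t refl f∈) f∈)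
      where
      above-> : ∀ t′ {g t″} → t ≡ t′ → (g , t″) ∈ above n t′ → x < g
      above-> (just h) eq (here refl) = s≤s (proj₁ (x-target eq))
      crossing : ∀ {g t₁ h t₂} → (∃ λ e → e ∈ low × (g , t₁) ≡ cutEntry x e) → View h t₂ → (h , t₂) ∈ above n t → g < h
      crossing (_ , e∈ , refl) _ f∈ = ≤-<-trans (low≤ e∈) (above-> t refl f∈)

    sound′ : ∀ {g t′} → (g , t′) ∈ es′ → 0 < g × Active (insert x ρ) g
    sound′ e∈ with view e∈
    ... | old e∈low with 0<g , A ← sound st (low⊆ e∈low) = 0<g , Active-below⁺ (low≤ e∈low) A
    ... | new eq with x≤h , A , S ← x-target eq = z<s , Active-above⁺ x≤h A S

    complete′ : ∀ {g} → 0 < g → Active (insert x ρ) g → ∃ λ t′ → (g , t′) ∈ es′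
    complete′ {g} 0<g A with g ≤? x
    complete′ {g} 0<g A | yes g≤x with t′ , e∈ ← complete st 0<g (Active-below⁻ x≤n g≤x A) =
      cut x t′ , ∈-++⁺ˡ (∈-map⁺ (cutEntry x) (low-complete e∈ g≤x))
    complete′ {zero}  0<g A | no g≰x = contradiction z≤n g≰x
    complete′ {suc h} 0<g A | no g≰x = raise n (just h) , ∈-++⁺ʳ (map (cutEntry x) low) (in-above t refl)
      where
      x≤h = s≤s⁻¹ (≰⇒> g≰x)
      in-above : ∀ t′ → t ≡ t′ → (suc h , raise n (just h)) ∈ above n t′
      in-above t′ eq with Ah , S ← Active-above⁻ x≤h A with refl ← trans (sym eq) (unique st x∈ Ah x≤h S) = here refl

    view-target : ∀ {g t′ k} → View g t′ → t′ ≡ just k → g ≤ k × Active (insert x ρ) k × Sep (insert x ρ) g k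
    view-target (old {t′ = t′} e∈low) eq with refl , k≤x ← cut-just⁻ x t′ eq with g≤k , A , S ← target st (low⊆ e∈low) =
      g≤k , Active-below⁺ k≤x A , Sep-below⁺ (low≤ e∈low) k≤x S
    view-target (new {h} eq′) eq with refl , refl ← raise-just⁻ n (just h) eq with x≤h , A , S ← x-target eq′ =
      ≤-refl , Active-above⁺ x≤h A S , Sep-above⁺ (perm st) x≤h ≤-refl (Sep-top (perm st))

    target′ : ∀ {g k} → (g , just k) ∈ es′ → g ≤ k × Active (insert x ρ) k × Sep (insert x ρ) g k
    target′ e∈ = view-target (view e∈) refl

    view-unique : ∀ {g t′ k} → View g t′ → 0 < g → Active (insert x ρ) k → g ≤ k → Sep (insert x ρ) g k → t′ ≡ just k
    view-unique {k = k} (old e∈low) 0<g A g≤k S with k ≤? x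
    ... | no  k≰x = contradiction S (¬Sep-across (perm st) x≤n 0<g (low≤ e∈low) (≰⇒> k≰x))
    ... | yes k≤x with refl ← unique st (low⊆ e∈low) (Active-below⁻ x≤n k≤x A) g≤k (Sep-below⁻ (low≤ e∈low) k≤x S) = cut-≤ k≤x
    view-unique {k = suc k} (new {h} eq) 0<g A g≤k S with x≤h , _ ← x-target eq
      with Ak , Sk ← Active-above⁻ (≤-trans x≤h (s≤s⁻¹ g≤k)) A
      with refl ← trans (sym eq) (unique st x∈ Ak (≤-trans x≤h (s≤s⁻¹ g≤k)) Sk)
      with n≤h , _ ← Sep-above⁻ (perm st) x≤h ≤-refl S
      with refl ← ≤-antisym n≤h (bounded Ak) = raise-top n

    unique′ : ∀ {g t′ k} → (g , t′) ∈ es′ → Active (insert x ρ) k → g ≤ k → Sep (insert x ρ) g k → t′ ≡ just k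
    unique′ e∈ = view-unique (view e∈) (proj₁ (sound′ e∈))

-- The four kinds of states and their children.

module Shapes where

  open Insertion
  open State
  open import Data.List using ([_])
  open import Data.List.Membership.Propositional using (_∈_)
  open import Data.List.Membership.Propositional.Properties using (∈-map⁺; ∈-++⁺ʳ)
  open import Data.List.Properties using (map-++; map-∘; ++-identityʳ; map-cong-local; ++-assoc; length-++; length-map; map-upTo)
  open import Data.List.Relation.Binary.Pointwise as Pointwise using (Pointwise; []; _∷_)
  open import Data.List.Relation.Unary.All as All using (All; []; _∷_)
  import Data.List.Relation.Unary.All.Properties as All
  open import Data.List.Relation.Unary.Any using (here; there)
  open import Data.Maybe using (Maybe; just; nothing)
  open import Data.Maybe.Properties using (just-injective)
  open import Data.Nat hiding (suc; zero; ℕ)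
  open import Data.Nat.Properties
  open import Data.Product using (proj₁; proj₂)
  open import Function.Base using (_∘_)
  open import Relation.Binary.PropositionalEquality hiding ([_])
  open import Relation.Nullary using (¬_)

  entries : (ℕ → Maybe ℕ) → List ℕ → List Entry
  entries τ = map (λ g → g , τ g)

  to : Maybe ℕ → ℕ → Maybe ℕ
  to t _ = t

  data Shape (n : ℕ) : Label → List Entry → Set where
    flat   : ∀ {b es} gs → length gs ≡ b → es ≡ entries (to nothing) gs → Shape n (flat b) es
    top₁   : ∀ {a b es} us ns → length us ≡ a → length ns ≡ b →
             es ≡ entries (to (just n)) us ++ entries (to nothing) ns ++ [ n , just n ] → Shape n (top₁ a b) es
    top₂   : ∀ {a b c es} ms ns v vs → length ms ≡ a → length ns ≡ b → length vs ≡ c →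
             es ≡ entries (to (just v)) ms ++ entries (to nothing) ns ++ entries just (v ∷ vs) ++ [ n , just n ] →
             Shape n (top₂ a b c) es
    capped : ∀ {a b c es} ms ns v vs k → length ms ≡ a → length ns ≡ b → length vs ≡ c →
             es ≡ entries (to (just v)) ms ++ entries (to nothing) ns ++ entries just (v ∷ vs) ++ [ k , nothing ] →
             Shape n (capped a b c) es

  HasLabel : List ℕ → Label → Set
  HasLabel ρ l = Σ (List Entry) λ es → State ρ es × Shape (length ρ) l es

  private
    hasLabel : ∀ {x ρ es l} → State (insert x ρ) es → Shape (suc (length ρ)) l es → HasLabel (insert x ρ) l
    hasLabel {x} {ρ} {es} {l} st sh = es , st , subst (λ m → Shape m l es) (sym (length-insert x ρ)) sh

    entries-++ : ∀ τ us vs → entries τ (us ++ vs) ≡ entries τ us ++ entries τ vs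
    entries-++ τ = map-++ (λ g → g , τ g)

    entries-cong : ∀ {τ τ′ gs} → All (λ g → τ g ≡ τ′ g) gs → entries τ gs ≡ entries τ′ gs
    entries-cong h = map-cong-local (All.map (cong (_ ,_)) h)

    cut-entries : ∀ x τ gs → map (cutEntry x) (entries τ gs) ≡ entries (cut x ∘ τ) gs
    cut-entries x τ gs = sym (map-∘ gs)

    shift-entries : ∀ n t gs → map (shift n) (entries (to t) gs) ≡ entries (to (raise n t)) (map suc gs)
    shift-entries n t gs = trans (sym (map-∘ gs)) (map-∘ gs)

    ∈-entries : ∀ τ {g gs} → g ∈ gs → (g , τ g) ∈ entries τ gs
    ∈-entries τ = ∈-map⁺ (λ g → g , τ g)

    -- Insertion at a gap u inside a block whose survivors are given by τ. The two inequalities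
    -- place u between the entries before and after it, which decides what `cut` does to their
    -- survivors.
    insert-at : ∀ {ρ} τ A us u vs B → State ρ (A ++ entries τ (us ++ u ∷ vs) ++ B) →
      State (insert u ρ) (map (cutEntry u) A ++ entries (cut u ∘ τ) (us ++ [ u ]) ++ above (length ρ) (τ u))
      × (∀ {e} → e ∈ A ++ entries τ us → proj₁ e < u) × (∀ {e} → e ∈ entries τ vs ++ B → u < proj₁ e)
    insert-at {ρ} τ A us u vs B st =
      subst (State (insert u ρ)) result (State-insert st′) , All.lookup (proj₁ (State-sorted st′)) , All.lookup (proj₂ (State-sorted {pre = A ++ entries τ us} st′))
      where
      split : A ++ entries τ (us ++ u ∷ vs) ++ B ≡ (A ++ entries τ us) ++ (u , τ u) ∷ (entries τ vs ++ B)
      split = trans (cong (λ l → A ++ l ++ B) (entries-++ τ us (u ∷ vs)))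
        (trans (cong (A ++_) (++-assoc (entries τ us) _ B)) (sym (++-assoc A (entries τ us) _)))
      st′ : State ρ ((A ++ entries τ us) ++ (u , τ u) ∷ (entries τ vs ++ B))
      st′ = subst (State ρ) split st
      result : map (cutEntry u) ((A ++ entries τ us) ++ [ u , τ u ]) ++ above (length ρ) (τ u)
               ≡ map (cutEntry u) A ++ entries (cut u ∘ τ) (us ++ [ u ]) ++ above (length ρ) (τ u)
      result = trans (cong (_++ above (length ρ) (τ u)) (begin
          map (cutEntry u) ((A ++ entries τ us) ++ [ u , τ u ]) ≡⟨ cong (map (cutEntry u)) (++-assoc A (entries τ us) [ u , τ u ]) ⟩
          map (cutEntry u) (A ++ entries τ us ++ [ u , τ u ])   ≡⟨ cong (λ l → map (cutEntry u) (A ++ l)) (entries-++ τ us [ u ]) ⟨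
          map (cutEntry u) (A ++ entries τ (us ++ [ u ]))       ≡⟨ map-++ (cutEntry u) A _ ⟩
          map (cutEntry u) A ++ map (cutEntry u) (entries τ (us ++ [ u ])) ≡⟨ cong (map (cutEntry u) A ++_) (cut-entries u τ (us ++ [ u ])) ⟩
          map (cutEntry u) A ++ entries (cut u ∘ τ) (us ++ [ u ]) ∎))
        (++-assoc (map (cutEntry u) A) _ _)
        where open ≡-Reasoning

    insert-last : ∀ {ρ} A x t → State ρ (A ++ [ x , t ]) →
      State (insert x ρ) (map (cutEntry x) A ++ (x , cut x t) ∷ above (length ρ) t) × (∀ {e} → e ∈ A → proj₁ e < x)
    insert-last {ρ} A x t st = subst (State (insert x ρ))
      (trans (cong (_++ above (length ρ) t) (map-++ (cutEntry x) A [ x , t ])) (++-assoc (map (cutEntry x) A) _ _))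
      (State-insert st) , All.lookup (proj₁ (State-sorted st))

    -- An active top gap would be its own survivor by `Sep-top`. If no entry has survivor n, the top
    -- gap is inactive, and an insertion at 0 leaves no survivors.
    no-top : ∀ {ρ es} → State ρ es → All (λ e → proj₂ e ≢ just (length ρ)) es → HasLabel (insert 0 ρ) (flat (suc (length es)))
    no-top {ρ} {es} st targets = hasLabel (State-insert-0 st (inactive not-active))
      (flat (1 ∷ map suc (map proj₁ es)) (cong suc (trans (length-map suc (map proj₁ es)) (length-map proj₁ es)))
        (cong ((1 , nothing) ∷_) (shifted es targets)))
      where
      not-active : ¬ Active ρ (length ρ)
      not-active A with t , e∈ ← complete st (nonempty st) A =
        All.lookup targets e∈ (unique st e∈ A ≤-refl (Sep-top (perm st)))
      shifted : ∀ es → All (λ e → proj₂ e ≢ just (length ρ)) es → map (shift (length ρ)) es ≡ entries (to nothing) (map suc (map proj₁ es))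
      shifted []       []       = refl
      shifted (e ∷ es) (h ∷ hs) = cong₂ _∷_ (cong (_ ,_) (raise-≢ h)) (shifted es hs)

    -- Each gap is presented with the gaps before it in its block, because their number determines
    -- its label.
    Pointwise-upTo : ∀ {R : ℕ → Label → Set} (f : ℕ → Label) gs →
      (∀ us u vs → gs ≡ us ++ u ∷ vs → R u (f (length us))) → Pointwise R gs (map f (upTo (length gs)))
    Pointwise-upTo f []       h = []
    Pointwise-upTo {R} f (g ∷ gs) h = h [] g gs refl ∷ subst (Pointwise R gs)
      (trans (map-∘ (upTo (length gs))) (cong (map f) (map-upTo suc (length gs))))
      (Pointwise-upTo (f ∘ suc) gs (λ us u vs eq → h (g ∷ us) u vs (cong (g ∷_) eq)))

    length-snoc : ∀ (us : List ℕ) u → length (us ++ [ u ]) ≡ suc (length us)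
    length-snoc us u = trans (length-++ us) (+-comm (length us) 1)

  Children : List ℕ → List Entry → Label → Set
  Children ρ es l = Pointwise (λ g → HasLabel (insert g ρ)) (0 ∷ map proj₁ es) (children l)

  private
    gaps-entries : ∀ τ gs → map proj₁ (entries τ gs) ≡ gs
    gaps-entries τ []       = refl
    gaps-entries τ (g ∷ gs) = cong (g ∷_) (gaps-entries τ gs)

  children-flat : ∀ {ρ} gs → State ρ (entries (to nothing) gs) → Children ρ (entries (to nothing) gs) (flat (length gs))
  children-flat {ρ} gs st = subst (λ m → HasLabel (insert 0 ρ) (flat (suc m))) (length-map _ gs) (no-top st (All.map⁺ (All.tabulate λ _ ())))
    ∷ subst (λ l → Pointwise (λ g → HasLabel (insert g ρ)) l (map (λ j → flat (suc j)) (upTo (length gs)))) (sym (gaps-entries _ gs))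
        (Pointwise-upTo (λ j → flat (suc j)) gs step)
    where
    step : ∀ us u vs → gs ≡ us ++ u ∷ vs → HasLabel (insert u ρ) (flat (suc (length us)))
    step us u vs refl with st′ , _ ← insert-at (to nothing) [] us u vs [] (subst (State ρ) (sym (++-identityʳ _)) st) =
      hasLabel st′ (flat (us ++ [ u ]) (length-snoc us u) (++-identityʳ _))

  children-top₁ : ∀ {ρ} us ns → let n = length ρ ; es = entries (to (just n)) us ++ entries (to nothing) ns ++ [ n , just n ] in
                  State ρ es → Children ρ es (top₁ (length us) (length ns))
  children-top₁ {ρ} us ns st = zeroth
    ∷ subst (λ l → Pointwise (λ g → HasLabel (insert g ρ)) l _) (sym gaps)
      (Pointwise.++⁺ (Pointwise-upTo (λ i → top₁ 0 (suc i)) us at-us)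
      (Pointwise.++⁺ (Pointwise-upTo (λ j → flat (length us + suc j)) ns at-ns) (last ∷ [])))
    where
    n = length ρ
    es = entries (to (just n)) us ++ entries (to nothing) ns ++ [ n , just n ]
    top∈ : (n , just n) ∈ es
    top∈ = ∈-++⁺ʳ (entries (to (just n)) us) (∈-++⁺ʳ (entries (to nothing) ns) (here refl))
    gaps : map proj₁ es ≡ us ++ ns ++ [ n ]
    gaps = trans (map-++ proj₁ (entries (to (just n)) us) _) (cong₂ _++_ (gaps-entries _ us)
      (trans (map-++ proj₁ (entries (to nothing) ns) _) (cong (_++ [ n ]) (gaps-entries _ ns))))

    zeroth : HasLabel (insert 0 ρ) (top₁ (suc (length us)) (length ns))
    zeroth = hasLabel (State-insert-0 st (active (proj₂ (sound st top∈))))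
      (top₁ (1 ∷ map suc us) (map suc ns) (cong suc (length-map suc us)) (length-map suc ns)
        (cong ((1 , just (suc n)) ∷_) (begin
          map (shift n) es ≡⟨ map-++ (shift n) (entries (to (just n)) us) _ ⟩
          map (shift n) (entries (to (just n)) us) ++ map (shift n) (entries (to nothing) ns ++ [ n , just n ])
            ≡⟨ cong₂ _++_ (shift-entries n (just n) us) (map-++ (shift n) (entries (to nothing) ns) _) ⟩
          entries (to (raise n (just n))) (map suc us) ++ map (shift n) (entries (to nothing) ns) ++ [ suc n , raise n (just n) ]
            ≡⟨ cong₂ (λ t l → entries (to t) (map suc us) ++ l ++ [ suc n , t ]) (raise-top n) (shift-entries n nothing ns) ⟩
          entries (to (just (suc n))) (map suc us) ++ entries (to nothing) (map suc ns) ++ [ suc n , just (suc n) ] ∎)))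
      where open ≡-Reasoning

    -- The gaps up to u lose their survivor n, which lies above u, while n itself lives on as the
    -- survivor of u and becomes the new top gap.
    at-us : ∀ us₁ u us₂ → us ≡ us₁ ++ u ∷ us₂ → HasLabel (insert u ρ) (top₁ 0 (suc (length us₁)))
    at-us us₁ u us₂ refl with st′ , _ , u< ← insert-at (to (just n)) [] us₁ u us₂ (entries (to nothing) ns ++ [ n , just n ]) st =
      hasLabel st′ (top₁ [] (us₁ ++ [ u ]) refl (length-snoc us₁ u)
        (cong₂ (λ t t′ → entries (to t) (us₁ ++ [ u ]) ++ [ suc n , t′ ])
          (cut-> (u< (∈-++⁺ʳ (entries _ us₂) (∈-++⁺ʳ (entries _ ns) (here refl))))) (raise-top n)))

    at-ns : ∀ ns₁ u ns₂ → ns ≡ ns₁ ++ u ∷ ns₂ → HasLabel (insert u ρ) (flat (length us + suc (length ns₁)))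
    at-ns ns₁ u ns₂ refl with st′ , _ , u< ← insert-at (to nothing) (entries (to (just n)) us) ns₁ u ns₂ [ n , just n ] st =
      hasLabel st′ (flat (us ++ ns₁ ++ [ u ]) (trans (length-++ us) (cong (_+_ (length us)) (length-snoc ns₁ u))) (begin
        map (cutEntry u) (entries (to (just n)) us) ++ entries (to nothing) (ns₁ ++ [ u ]) ++ []
          ≡⟨ cong₂ _++_ (cut-entries u (to (just n)) us) (++-identityʳ _) ⟩
        entries (to (cut u (just n))) us ++ entries (to nothing) (ns₁ ++ [ u ])
          ≡⟨ cong (λ t → entries (to t) us ++ entries (to nothing) (ns₁ ++ [ u ])) (cut-> (u< (∈-++⁺ʳ (entries _ ns₂) (here refl)))) ⟩
        entries (to nothing) us ++ entries (to nothing) (ns₁ ++ [ u ]) ≡⟨ entries-++ (to nothing) us _ ⟨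
        entries (to nothing) (us ++ ns₁ ++ [ u ]) ∎))
      where open ≡-Reasoning

    -- The a gaps keep n as survivor, but n is no longer the top gap: it becomes the v of `top₂`,
    -- still surviving itself, below the new top n + 1.
    last : HasLabel (insert n ρ) (top₂ (length us) (length ns) 0)
    last with st′ , _ ← insert-last (entries (to (just n)) us ++ entries (to nothing) ns) n (just n)
                          (subst (State ρ) (sym (++-assoc (entries (to (just n)) us) _ _)) st) =
      hasLabel st′ (top₂ us ns n [] refl refl refl (begin
        map (cutEntry n) (entries (to (just n)) us ++ entries (to nothing) ns) ++ (n , cut n (just n)) ∷ [ suc n , raise n (just n) ]
          ≡⟨ cong (_++ (n , cut n (just n)) ∷ [ suc n , raise n (just n) ]) (trans (map-++ (cutEntry n) (entries (to (just n)) us) _)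
               (cong₂ _++_ (cut-entries n (to (just n)) us) (cut-entries n (to nothing) ns))) ⟩
        (entries (to (cut n (just n))) us ++ entries (to nothing) ns) ++ (n , cut n (just n)) ∷ [ suc n , raise n (just n) ]
          ≡⟨ cong₂ (λ t t′ → (entries (to t) us ++ entries (to nothing) ns) ++ (n , t) ∷ [ suc n , t′ ]) (cut-≤ ≤-refl) (raise-top n) ⟩
        (entries (to (just n)) us ++ entries (to nothing) ns) ++ (n , just n) ∷ [ suc n , just (suc n) ]
          ≡⟨ ++-assoc (entries (to (just n)) us) _ _ ⟩
        entries (to (just n)) us ++ entries (to nothing) ns ++ (n , just n) ∷ [ suc n , just (suc n) ] ∎))
      where open ≡-Reasoning

  -- `top₂` and `capped` differ in the last entry (x , t) alone, and insertions strictly between 0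
  -- and x are treated for both together.
  module _ {ρ : List ℕ} (ms ns : List ℕ) (v : ℕ) (vs : List ℕ) (x : ℕ) (t : Maybe ℕ) (st : State ρ (entries (to (just v)) ms ++ entries (to nothing) ns ++ entries just (v ∷ vs) ++ [ x , t ])) where
    private
      n = length ρ
      a = length ms
      b = length ns
      c = length vs
      M = entries (to (just v)) ms
      N = entries (to nothing) ns
      V = entries just (v ∷ vs)
      es = M ++ N ++ V ++ [ x , t ]

      R : ℕ → Label → Set
      R g = HasLabel (insert g ρ)

      gaps : map proj₁ es ≡ (ms ++ ns) ++ (v ∷ vs) ++ [ x ]
      gaps = begin
        map proj₁ es ≡⟨ map-++ proj₁ M _ ⟩
        map proj₁ M ++ map proj₁ (N ++ V ++ [ x , t ]) ≡⟨ cong₂ _++_ (gaps-entries _ ms) (map-++ proj₁ N _) ⟩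
        ms ++ map proj₁ N ++ map proj₁ (V ++ [ x , t ]) ≡⟨ cong (ms ++_) (cong₂ _++_ (gaps-entries _ ns) (map-++ proj₁ V _)) ⟩
        ms ++ ns ++ map proj₁ V ++ [ x ] ≡⟨ cong (λ l → ms ++ ns ++ l ++ [ x ]) (gaps-entries just (v ∷ vs)) ⟩
        ms ++ ns ++ (v ∷ vs) ++ [ x ] ≡⟨ ++-assoc ms ns _ ⟨
        (ms ++ ns) ++ (v ∷ vs) ++ [ x ] ∎
        where open ≡-Reasoning

      at-last = insert-last (M ++ N ++ V) x t (subst (State ρ)
        (sym (trans (++-assoc M (N ++ V) _) (cong (M ++_) (++-assoc N V _)))) st)

      x≤n : x ≤ n
      x≤n = bounded (proj₂ (sound st (∈-++⁺ʳ M (∈-++⁺ʳ N (∈-++⁺ʳ V (here refl))))))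

      V<x : ∀ {w} → w ∈ v ∷ vs → w < x
      V<x w∈ = proj₂ at-last (∈-++⁺ʳ M (∈-++⁺ʳ N (∈-entries just w∈)))

      V≢n : ∀ {w} → w ∈ v ∷ vs → just w ≢ just n
      V≢n w∈ eq = <⇒≱ (V<x w∈) (subst (x ≤_) (sym (just-injective eq)) x≤n)

      -- The survivor v of u lies above u and below the top. So the gaps up to u lose it, and v + 1
      -- is active without a survivor of its own.
      at-ms : ∀ ms₁ u ms₂ → ms ≡ ms₁ ++ u ∷ ms₂ → R u (flat (2 + length ms₁))
      at-ms ms₁ u ms₂ refl with st′ , _ , u< ← insert-at (to (just v)) [] ms₁ u ms₂ (N ++ V ++ [ x , t ]) st =
        hasLabel st′ (flat (ms₁ ++ u ∷ suc v ∷ []) (trans (length-++ ms₁) (+-comm (length ms₁) 2)) (begin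
          entries (to (cut u (just v))) (ms₁ ++ [ u ]) ++ [ suc v , raise n (just v) ]
            ≡⟨ cong₂ (λ t t′ → entries (to t) (ms₁ ++ [ u ]) ++ [ suc v , t′ ])
                 (cut-> (u< (∈-++⁺ʳ (entries _ ms₂) (∈-++⁺ʳ N (here refl))))) (raise-≢ (V≢n (here refl))) ⟩
          entries (to nothing) (ms₁ ++ [ u ]) ++ [ suc v , nothing ] ≡⟨ entries-++ (to nothing) (ms₁ ++ [ u ]) [ suc v ] ⟨
          entries (to nothing) ((ms₁ ++ [ u ]) ++ [ suc v ]) ≡⟨ cong (entries (to nothing)) (++-assoc ms₁ [ u ] [ suc v ]) ⟩
          entries (to nothing) (ms₁ ++ u ∷ suc v ∷ []) ∎))
        where open ≡-Reasoning

      at-ns : ∀ ns₁ u ns₂ → ns ≡ ns₁ ++ u ∷ ns₂ → R u (flat (a + suc (length ns₁)))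
      at-ns ns₁ u ns₂ refl with st′ , _ , u< ← insert-at (to nothing) M ns₁ u ns₂ (V ++ [ x , t ]) st =
        hasLabel st′ (flat (ms ++ ns₁ ++ [ u ]) (trans (length-++ ms) (cong (_+_ a) (length-snoc ns₁ u))) (begin
          map (cutEntry u) M ++ entries (to nothing) (ns₁ ++ [ u ]) ++ []
            ≡⟨ cong₂ _++_ (cut-entries u (to (just v)) ms) (++-identityʳ _) ⟩
          entries (to (cut u (just v))) ms ++ entries (to nothing) (ns₁ ++ [ u ])
            ≡⟨ cong (λ t → entries (to t) ms ++ entries (to nothing) (ns₁ ++ [ u ])) (cut-> (u< (∈-++⁺ʳ (entries _ ns₂) (here refl)))) ⟩
          entries (to nothing) ms ++ entries (to nothing) (ns₁ ++ [ u ]) ≡⟨ entries-++ (to nothing) ms _ ⟨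
          entries (to nothing) (ms ++ ns₁ ++ [ u ]) ∎))
        where open ≡-Reasoning

      -- All survivors of gaps up to w are at most w and are kept. The gap w survives itself, which
      -- adds w + 1; not being the top gap, it has no survivor and closes the list as a cap.
      at-vs : ∀ ws₁ w ws₂ → v ∷ vs ≡ ws₁ ++ w ∷ ws₂ → R w (capped a b (length ws₁))
      at-vs ws₁ w ws₂ eq with st′ , <w , _ ← insert-at just (M ++ N) ws₁ w ws₂ [ x , t ]
        (subst (State ρ) (trans (sym (++-assoc M N _)) (cong (λ l → (M ++ N) ++ entries just l ++ [ x , t ]) eq)) st) =
        hasLabel st′ (capped ms ns v (proj₁ (head ws₁ eq)) (suc w) refl refl (proj₁ (proj₂ (head ws₁ eq))) (begin
          map (cutEntry w) (M ++ N) ++ entries (cut w ∘ just) (ws₁ ++ [ w ]) ++ [ suc w , raise n (just w) ]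
            ≡⟨ cong₂ _++_ (trans (map-++ (cutEntry w) M N) (cong₂ _++_ (cut-entries w _ ms) (cut-entries w _ ns)))
                 (cong₂ (λ l t → l ++ [ suc w , t ]) (entries-cong (All.++⁺ (All.tabulate below-w) (cut-≤ ≤-refl ∷ [])))
                   (raise-≢ (V≢n (subst (w ∈_) (sym eq) (∈-++⁺ʳ ws₁ (here refl)))))) ⟩
          (entries (to (cut w (just v))) ms ++ N) ++ entries just (ws₁ ++ [ w ]) ++ [ suc w , nothing ]
            ≡⟨ ++-assoc (entries _ ms) N _ ⟩
          entries (to (cut w (just v))) ms ++ N ++ entries just (ws₁ ++ [ w ]) ++ [ suc w , nothing ]
            ≡⟨ cong₂ (λ t l → entries (to t) ms ++ N ++ entries just l ++ [ suc w , nothing ]) (cut-≤ (v≤w ws₁ eq <w)) (proj₂ (proj₂ (head ws₁ eq))) ⟩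
          M ++ N ++ entries just (v ∷ proj₁ (head ws₁ eq)) ++ [ suc w , nothing ] ∎))
        where
        open ≡-Reasoning
        -- The block up to w starts with v even if w is v, and its first element is not counted in
        -- the label.
        head : ∀ ws₁ → v ∷ vs ≡ ws₁ ++ w ∷ ws₂ → ∃ λ us → length us ≡ length ws₁ × ws₁ ++ [ w ] ≡ v ∷ us
        head []        refl = [] , refl , refl
        head (_ ∷ ws₁) refl = ws₁ ++ [ w ] , length-snoc ws₁ w , refl
        v≤w : ∀ ws₁ → v ∷ vs ≡ ws₁ ++ w ∷ ws₂ → (∀ {e} → e ∈ (M ++ N) ++ entries just ws₁ → proj₁ e < w) → v ≤ w
        v≤w []        refl <w = ≤-refl
        v≤w (_ ∷ ws₁) refl <w = <⇒≤ (<w (∈-++⁺ʳ (M ++ N) (here refl)))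
        below-w : ∀ {u} → u ∈ ws₁ → cut w (just u) ≡ just u
        below-w u∈ = cut-≤ (<⇒≤ (<w (∈-++⁺ʳ (M ++ N) (∈-entries just u∈))))

      inner : ∀ {l} → R x l → Pointwise R (map proj₁ es) (below a b ++ map (capped a b) (upTo (suc c)) ++ [ l ])
      inner {l} r = subst (λ gs → Pointwise R gs (below a b ++ map (capped a b) (upTo (suc c)) ++ [ l ])) (sym gaps) (Pointwise.++⁺
        (Pointwise.++⁺ (Pointwise-upTo (λ i → flat (2 + i)) ms at-ms) (Pointwise-upTo (λ j → flat (a + suc j)) ns at-ns))
        (Pointwise.++⁺ (Pointwise-upTo (capped a b) (v ∷ vs) at-vs) (r ∷ [])))

      M++N++V-cut : map (cutEntry x) (M ++ N ++ V) ≡ M ++ N ++ V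
      M++N++V-cut = begin
        map (cutEntry x) (M ++ N ++ V) ≡⟨ trans (map-++ (cutEntry x) M _) (cong (map (cutEntry x) M ++_) (map-++ (cutEntry x) N V)) ⟩
        map (cutEntry x) M ++ map (cutEntry x) N ++ map (cutEntry x) V
          ≡⟨ cong₂ _++_ (cut-entries x _ ms) (cong₂ _++_ (cut-entries x _ ns) (cut-entries x just (v ∷ vs))) ⟩
        entries (to (cut x (just v))) ms ++ N ++ entries (cut x ∘ just) (v ∷ vs)
          ≡⟨ cong₂ (λ t l → entries (to t) ms ++ N ++ l) (cut-≤ (<⇒≤ (V<x (here refl))))
               (entries-cong (All.tabulate λ w∈ → cut-≤ (<⇒≤ (V<x w∈)))) ⟩
        M ++ N ++ V ∎
        where open ≡-Reasoning

    -- All survivors are below the last gap, which has none itself. Insertion there changes no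
    -- entry, whence the label is its own last child.
    children-capped : t ≡ nothing → Children ρ es (capped a b c)
    children-capped refl = subst (λ m → R 0 (flat m)) size (no-top st targets)
      ∷ inner (hasLabel (proj₁ at-last) (capped ms ns v vs x refl refl refl
          (trans (cong (_++ [ x , nothing ]) M++N++V-cut) (trans (++-assoc M (N ++ V) _) (cong (M ++_) (++-assoc N V _))))))
      where
      targets : All (λ e → proj₂ e ≢ just n) es
      targets = All.++⁺ (off-top (to (just v)) ms (λ _ → V≢n (here refl))) (All.++⁺ (off-top (to nothing) ns (λ _ ()))
        (All.++⁺ (off-top just (v ∷ vs) V≢n) ((λ ()) ∷ [])))
        where
        off-top : ∀ τ gs → (∀ {g} → g ∈ gs → τ g ≢ just n) → All (λ e → proj₂ e ≢ just n) (entries τ gs)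
        off-top τ gs h = All.map⁺ (All.tabulate h)
      size : suc (length es) ≡ a + b + suc c + 2
      size = begin
        suc (length es) ≡⟨ cong suc (trans (sym (length-map proj₁ es)) (cong length gaps)) ⟩
        suc (length ((ms ++ ns) ++ (v ∷ vs) ++ [ x ])) ≡⟨ cong suc (trans (length-++ (ms ++ ns) {(v ∷ vs) ++ [ x ]}) (cong₂ _+_ (length-++ ms {ns}) (length-snoc (v ∷ vs) x))) ⟩
        suc (a + b + suc (suc c)) ≡⟨ cong suc (+-suc (a + b) (suc c)) ⟩
        2 + (a + b + suc c) ≡⟨ +-comm 2 _ ⟩
        a + b + suc c + 2 ∎
        where open ≡-Reasoning

    -- Insertion at n makes n the newest gap of the block that survives itself. Insertion at 0 keeps
    -- only the survivor of n, so the three blocks merge into one without survivors.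
    children-top₂ : x ≡ n → t ≡ just n → Children ρ es (top₂ a b c)
    children-top₂ refl refl = zeroth ∷ inner (hasLabel (proj₁ at-last) (top₂ ms ns v (vs ++ [ n ]) refl refl (length-snoc vs n) (begin
        map (cutEntry n) (M ++ N ++ V) ++ (n , cut n (just n)) ∷ [ suc n , raise n (just n) ]
          ≡⟨ cong₂ _++_ M++N++V-cut (cong₂ (λ t t′ → (n , t) ∷ [ suc n , t′ ]) (cut-≤ ≤-refl) (raise-top n)) ⟩
        (M ++ N ++ V) ++ (n , just n) ∷ [ suc n , just (suc n) ] ≡⟨ trans (++-assoc M (N ++ V) _) (cong (M ++_) (++-assoc N V _)) ⟩
        M ++ N ++ V ++ (n , just n) ∷ [ suc n , just (suc n) ] ≡⟨ cong (λ l → M ++ N ++ l) (++-assoc V [ n , just n ] _) ⟨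
        M ++ N ++ (V ++ [ n , just n ]) ++ [ suc n , just (suc n) ] ≡⟨ cong (λ l → M ++ N ++ l ++ [ suc n , just (suc n) ]) (entries-++ just (v ∷ vs) [ n ]) ⟨
        M ++ N ++ entries just (v ∷ vs ++ [ n ]) ++ [ suc n , just (suc n) ] ∎)))
      where
      open ≡-Reasoning
      zeroth : R 0 (top₁ 1 (a + b + suc c))
      zeroth = hasLabel (State-insert-0 st (active (proj₂ (sound st (∈-++⁺ʳ M (∈-++⁺ʳ N (∈-++⁺ʳ V (here refl))))))))
        (top₁ [ 1 ] (map suc ((ms ++ ns) ++ v ∷ vs)) refl
          (trans (length-map suc ((ms ++ ns) ++ v ∷ vs)) (trans (length-++ (ms ++ ns) {v ∷ vs}) (cong (_+ suc c) (length-++ ms {ns}))))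
          (cong ((1 , just (suc n)) ∷_) (begin
            map (shift n) es ≡⟨ trans (map-++ (shift n) M _) (cong (map (shift n) M ++_) (trans (map-++ (shift n) N _)
                                  (cong (map (shift n) N ++_) (map-++ (shift n) V _)))) ⟩
            map (shift n) M ++ map (shift n) N ++ map (shift n) V ++ [ suc n , raise n (just n) ]
              ≡⟨ cong₂ _++_ (lowered ms (to (just v)) (λ _ → V≢n (here refl))) (cong₂ _++_ (lowered ns (to nothing) (λ _ ()))
                   (cong₂ (λ l t → l ++ [ suc n , t ]) (lowered (v ∷ vs) just V≢n) (raise-top n))) ⟩
            E (map suc ms) ++ E (map suc ns) ++ E (map suc (v ∷ vs)) ++ [ suc n , just (suc n) ] ≡⟨ ++-assoc (E (map suc ms)) _ _ ⟨
            (E (map suc ms) ++ E (map suc ns)) ++ E (map suc (v ∷ vs)) ++ [ suc n , just (suc n) ] ≡⟨ ++-assoc (E (map suc ms) ++ E (map suc ns)) _ _ ⟨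
            ((E (map suc ms) ++ E (map suc ns)) ++ E (map suc (v ∷ vs))) ++ [ suc n , just (suc n) ]
              ≡⟨ cong (_++ [ suc n , just (suc n) ]) (trans (cong E (trans (map-++ suc (ms ++ ns) _) (cong (_++ map suc (v ∷ vs)) (map-++ suc ms ns))))
                   (trans (entries-++ (to nothing) (map suc ms ++ map suc ns) (map suc (v ∷ vs))) (cong (_++ E (map suc (v ∷ vs))) (entries-++ (to nothing) (map suc ms) (map suc ns))))) ⟨
            E (map suc ((ms ++ ns) ++ v ∷ vs)) ++ [ suc n , just (suc n) ] ∎)))
        where
        E : List ℕ → List Entry
        E = entries (to nothing)
        lowered : ∀ gs τ → (∀ {g} → g ∈ gs → τ g ≢ just n) → map (shift n) (entries τ gs) ≡ E (map suc gs)
        lowered []       τ h = refl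
        lowered (g ∷ gs) τ h = cong₂ _∷_ (cong (suc g ,_) (raise-≢ (h (here refl)))) (lowered gs τ (h ∘ there))

  children-labels : ∀ {ρ es l} → State ρ es → Shape (length ρ) l es → Children ρ es l
  children-labels st (flat gs refl refl)                       = children-flat gs st
  children-labels st (top₁ us ns refl refl refl)               = children-top₁ us ns st
  children-labels st (top₂ ms ns v vs refl refl refl refl)     = children-top₂ ms ns v vs _ _ st refl refl
  children-labels st (capped ms ns v vs k refl refl refl refl) = children-capped ms ns v vs k nothing st refl

-- Each avoiding word is a node of the tree exactly once.

module Enumeration where

  open Insertion
  open State
  open Shapes using (HasLabel; children-labels)
  open import Data.List using ([_]; concat; concatMap)
  open import Data.List.Membership.Propositional using (_∈_)
  open import Data.List.Membership.Propositional.Properties using (∈-map⁺; ∈-map⁻; ∈-concat⁺′; ∈-concat⁻′)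
  open import Data.List.Properties using (map-++; map-∘; map-concatMap)
  open import Data.List.Relation.Binary.Disjoint.Propositional using (Disjoint)
  open import Data.List.Relation.Binary.Permutation.Propositional using (↭-refl)
  open import Data.List.Relation.Binary.Permutation.Propositional.Properties using (↭-length; ↭-empty-inv)
  open import Data.List.Relation.Binary.Pointwise using (Pointwise; []; _∷_)
  open import Data.List.Relation.Unary.All as All using ([]; _∷_)
  import Data.List.Relation.Unary.All.Properties as All
  open import Data.List.Relation.Unary.AllPairs as AllPairs using ([]; _∷_)
  import Data.List.Relation.Unary.AllPairs.Properties as AllPairs
  open import Data.List.Relation.Unary.Any using (here; there)
  open import Data.List.Relation.Unary.Unique.Propositional using (Unique)
  import Data.List.Relation.Unary.Unique.Propositional.Properties as Unique
  open import Data.Maybe using (just)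
  open import Data.Nat hiding (suc; zero; ℕ)
  open import Data.Nat.ListAction.Properties using (sum-++)
  open import Data.Nat.Properties
  open import Data.Product using (proj₁; proj₂)
  open import Function.Base using (_∘_)
  open import Relation.Binary.PropositionalEquality hiding ([_])

  Node : Set
  Node = Σ (List ℕ) λ ρ → Σ Label (HasLabel ρ)

  word : Node → List ℕ
  word = proj₁

  label : Node → Label
  label = proj₁ ∘ proj₂

  -- The tree starts with length 1: for the empty word the top gap would be the gap 0.
  root : Node
  root = 0 ∷ [] , top₁ 0 0 , (1 , just 1) ∷ [] , state , Shapes.top₁ [] [] refl refl refl
    where
    active-1 : Active (insert 0 []) 1
    active-1 = Active-above⁺ z≤n (Active-0 []) (Sep-0 [] 0)
    state : State (insert 0 []) ((1 , just 1) ∷ [])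
    state = record
      { perm     = ↭-refl
      ; avoiding = Avoiding-insert⁺ (record { no-4231 = λ () ; no-3214 = λ () }) (Active-0 [])
      ; nonempty = s≤s z≤n
      ; sorted   = [] ∷ []
      ; sound    = λ { (here refl) → s≤s z≤n , active-1 }
      ; complete = λ 0<g A → just 1 , here (cong (_, just 1) (≤-antisym (bounded A) 0<g))
      ; target   = λ { (here refl) → ≤-refl , active-1 , Sep-top ↭-refl }
      ; unique   = λ { (here refl) A 1≤k _ → cong just (≤-antisym 1≤k (bounded A)) }
      }

  gaps : Node → List ℕ
  gaps (_ , _ , es , _) = 0 ∷ map proj₁ es

  private
    collect : ∀ {ρ gs ls} → Pointwise (λ g → HasLabel (insert g ρ)) gs ls → List Node
    collect []                        = []
    collect {ρ} (_∷_ {x = g} {y = l} h hs) = (insert g ρ , l , h) ∷ collect hs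

    collect-label : ∀ {ρ gs ls} (p : Pointwise (λ g → HasLabel (insert g ρ)) gs ls) → map label (collect p) ≡ ls
    collect-label []       = refl
    collect-label (_ ∷ hs) = cong (_ ∷_) (collect-label hs)

    collect-word : ∀ {ρ gs ls} (p : Pointwise (λ g → HasLabel (insert g ρ)) gs ls) → map word (collect p) ≡ map (λ g → insert g ρ) gs
    collect-word []       = refl
    collect-word (_ ∷ hs) = cong (_ ∷_) (collect-word hs)

  kids : Node → List Node
  kids (ρ , l , es , st , sh) = collect (children-labels st sh)

  kids-label : ∀ N → map label (kids N) ≡ children (label N)
  kids-label (ρ , l , es , st , sh) = collect-label (children-labels st sh)

  kids-word : ∀ N → map word (kids N) ≡ map (λ g → insert g (word N)) (gaps N)
  kids-word (ρ , l , es , st , sh) = collect-word (children-labels st sh)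

  nodes : ℕ → List Node
  nodes zero    = [ root ]
  nodes (suc n) = concatMap kids (nodes n)

  weight : ℕ → List Node → ℕ
  weight m Ns = sum (map (descendants m ∘ label) Ns)

  weight-kids : ∀ m N → weight m (kids N) ≡ descendants (suc m) (label N)
  weight-kids m N = cong sum (trans (map-∘ (kids N)) (cong (map (descendants m)) (kids-label N)))

  weight-concatMap : ∀ m Ns → weight m (concatMap kids Ns) ≡ weight (suc m) Ns
  weight-concatMap m []       = refl
  weight-concatMap m (N ∷ Ns) = begin
    weight m (kids N ++ concatMap kids Ns) ≡⟨ cong sum (map-++ (descendants m ∘ label) (kids N) _) ⟩
    sum (map (descendants m ∘ label) (kids N) ++ map (descendants m ∘ label) (concatMap kids Ns)) ≡⟨ sum-++ (map (descendants m ∘ label) (kids N)) _ ⟩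
    weight m (kids N) + weight m (concatMap kids Ns) ≡⟨ cong₂ _+_ (weight-kids m N) (weight-concatMap m Ns) ⟩
    weight (suc m) (N ∷ Ns) ∎
    where open ≡-Reasoning

  -- Passing from a list of nodes to their children trades one generation of descendants for one of
  -- nodes and leaves the total unchanged; m = 0 counts the nodes.
  weight-nodes : ∀ m n → weight m (nodes n) ≡ descendants (m + n) (top₁ 0 0)
  weight-nodes m zero    = trans (+-identityʳ _) (cong (λ k → descendants k (top₁ 0 0)) (sym (+-identityʳ m)))
  weight-nodes m (suc n) = trans (weight-concatMap m (nodes n)) (trans (weight-nodes (suc m) n)
    (cong (λ k → descendants k (top₁ 0 0)) (sym (+-suc m n))))

  length-nodes : ∀ n → length (nodes n) ≡ descendants n (top₁ 0 0)
  length-nodes n = trans (lemma (nodes n)) (weight-nodes 0 n)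
    where
    lemma : ∀ Ns → length Ns ≡ weight 0 Ns
    lemma []       = refl
    lemma (_ ∷ Ns) = cong suc (lemma Ns)

  words : ℕ → List (List ℕ)
  words n = map word (nodes n)

  words-suc : ∀ n → words (suc n) ≡ concat (map (map word ∘ kids) (nodes n))
  words-suc n = map-concatMap word kids (nodes n)

  length-word : ∀ n {N} → N ∈ nodes n → length (word N) ≡ suc n
  length-word zero    (here refl) = refl
  length-word (suc n) {N} N∈ with _ , N∈kids , kids∈ ← ∈-concat⁻′ (map kids (nodes n)) N∈
    with P , P∈ , refl ← ∈-map⁻ kids kids∈
    with g , _ , eq ← ∈-map⁻ (λ g → insert g (word P)) (subst (word N ∈_) (kids-word P) (∈-map⁺ word N∈kids)) =
      trans (cong length eq) (trans (length-insert g (word P)) (cong suc (length-word n P∈)))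

  words-sound : ∀ n {ρ} → ρ ∈ words n → IsPerm (suc n) ρ × Avoiding ρ
  words-sound n ρ∈ with (ρ , l , es , st , sh) , N∈ , refl ← ∈-map⁻ word ρ∈ =
    subst (λ m → IsPerm m ρ) (length-word n N∈) (perm st) , avoiding st

  IsPerm-length : ∀ {n ρ} → IsPerm n ρ → length ρ ≡ n
  IsPerm-length {n} P = trans (↭-length P) (length-upTo n)
    where open import Data.List.Properties using (length-upTo)

  -- Deleting the last entry leaves an avoiding word, and the gap of that entry is active, so it is
  -- listed at the node found by induction.
  words-complete : ∀ n {ρ} → IsPerm (suc n) ρ → Avoiding ρ → ρ ∈ words n
  words-complete zero P V with x , ρ , refl , x≤0 , P′ ← IsPerm-insert⁻ P with refl ← ↭-empty-inv P′ | refl ← n≤0⇒n≡0 x≤0 = here refl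
  words-complete (suc n) P V with x , ρ , refl , x≤n , P′ ← IsPerm-insert⁻ P
    with V′ , A ← Avoiding-insert⁻ (≤-trans x≤n (≤-reflexive (sym (IsPerm-length P′)))) V
    with N@(_ , _ , es , st , sh) , N∈ , refl ← ∈-map⁻ word (words-complete n P′ V′) =
    subst (insert x ρ ∈_) (sym (words-suc n)) (∈-concat⁺′
      (subst (insert x ρ ∈_) (sym (kids-word N)) (∈-map⁺ (λ g → insert g ρ) (x∈gaps x A)))
      (∈-map⁺ (map word ∘ kids) N∈))
    where
    x∈gaps : ∀ x → Active ρ x → x ∈ gaps N
    x∈gaps zero    A = here refl
    x∈gaps (suc x) A = there (∈-map⁺ proj₁ (proj₂ (complete st z<s A)))

  gaps-unique : ∀ N → Unique (gaps N)
  gaps-unique (_ , _ , es , st , _) = AllPairs.map <⇒≢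
    (All.map⁺ (All.tabulate λ e∈ → proj₁ (sound st e∈)) ∷ AllPairs.map⁺ (sorted st))

  -- A word determines its parent and the gap used, by `insert-injective`: siblings differ in the
  -- gap and other words of a generation in the parent.
  words-unique : ∀ n → Unique (words n)
  words-unique zero    = [] ∷ []
  words-unique (suc n) = subst Unique (sym (words-suc n)) (Unique.concat⁺
    (All.map⁺ (All.tabulate λ {N} _ → subst Unique (sym (kids-word N)) (Unique.map⁺ (proj₁ ∘ insert-injective) (gaps-unique N))))
    (AllPairs.map⁺ (AllPairs.map (λ {N} {N′} → disjoint {N} {N′}) (AllPairs.map⁻ (words-unique n)))))
    where
    disjoint : ∀ {N N′} → word N ≢ word N′ → Disjoint (map word (kids N)) (map word (kids N′))
    disjoint {N} {N′} N≢N′ (ρ∈ , ρ∈′)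
      with _ , _ , refl ← ∈-map⁻ (λ g → insert g (word N)) (subst (_ ∈_) (kids-word N) ρ∈)
      with _ , _ , eq ← ∈-map⁻ (λ g → insert g (word N′)) (subst (_ ∈_) (kids-word N′) ρ∈′) = N≢N′ (proj₂ (insert-injective eq))

-- From avoiding words to the counting function of the class.

module Counting where

  open Insertion
  open Enumeration
  open import Data.Fin using (zero; suc; cast)
  open import Data.List using ([_]; reverse; lookup)
  open import Data.List.Membership.Propositional using (_∈_)
  open import Data.List.Membership.Propositional.Properties using (∈-map⁺; ∈-map⁻; ∈-lookup)
  open import Data.List.Membership.Propositional.Properties.WithK using (unique∧set⇒bag)
  open import Data.List.Properties using (length-map; reverse-injective; reverse-involutive)
  open import Data.List.Relation.Binary.BagAndSetEquality using (∼bag⇒↭)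
  open import Data.List.Relation.Binary.Permutation.Propositional using (↭-refl; ↭-sym; ↭-trans)
  open import Data.List.Relation.Binary.Permutation.Propositional.Properties using (↭-length; ↭-empty-inv; ↭-reverse)
  open import Data.List.Relation.Binary.Sublist.Propositional using (_⊆_)
  open import Data.List.Relation.Binary.Sublist.Heterogeneous.Properties using (reverse⁺)
  open import Data.List.Relation.Unary.Any using (here; there)
  open import Data.List.Relation.Unary.All using ([])
  open import Data.List.Relation.Unary.AllPairs using ([]; _∷_)
  open import Data.List.Relation.Unary.Unique.Propositional using (Unique)
  import Data.List.Relation.Unary.Unique.Propositional.Properties as Unique
  open import Data.Nat hiding (suc; zero; ℕ)
  open import Data.Nat.Properties
  open import Function.Base using (_∘_)
  open import Function.Bundles using (_⇔_; mk⇔; Equivalence)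
  open import Relation.Binary.Definitions using (tri<; tri≈; tri>)
  open import Relation.Binary.PropositionalEquality hiding ([_])
  open import Relation.Nullary using (contradiction)

  lookup-map-cast : ∀ (f : ℕ → ℕ) xs i .(eq : length (map f xs) ≡ length xs) → lookup (map f xs) i ≡ f (lookup xs (cast eq i))
  lookup-map-cast f (x ∷ xs) zero    eq = refl
  lookup-map-cast f (x ∷ xs) (suc i) eq = lookup-map-cast f xs i (suc-injective eq)

  -- Monotonicity gives one direction; the order on ℕ being total, it also gives the other.
  map-OrderIso : ∀ (f : ℕ → ℕ) xs → (∀ {u v} → u ∈ xs → v ∈ xs → u < v → f u < f v) → OrderIso (map f xs) xs
  map-OrderIso f xs mono = length-map f xs , λ i j → mk⇔
    (λ lt → cancel (∈-lookup (cast eq i)) (∈-lookup (cast eq j)) (subst₂ _<_ (lookup-map-cast f xs i eq) (lookup-map-cast f xs j eq) lt))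
    (λ lt → subst₂ _<_ (sym (lookup-map-cast f xs i eq)) (sym (lookup-map-cast f xs j eq)) (mono (∈-lookup (cast eq i)) (∈-lookup (cast eq j)) lt))
    where
    eq = length-map f xs
    cancel : ∀ {u v} → u ∈ xs → v ∈ xs → f u < f v → u < v
    cancel {u} {v} u∈ v∈ lt with <-cmp u v
    ... | tri< u<v _ _  = u<v
    ... | tri≈ _ refl _ = contradiction lt (<-irrefl refl)
    ... | tri> _ _ v<u  = contradiction lt (<⇒≯ (mono v∈ u∈ v<u))

  module _ {w₀ w₁ w₂ w₃ : ℕ} (w₀<w₁ : w₀ < w₁) (w₁<w₂ : w₁ < w₂) (w₂<w₃ : w₂ < w₃) where
    -- Sends the letters 0 to 3 of a pattern to the values of an occurrence, which thereby is the
    -- image of the pattern under a monotone map.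
    values : ℕ → ℕ
    values 0 = w₀
    values 1 = w₁
    values 2 = w₂
    values _ = w₃

    values-mono : ∀ {u v} → v < 4 → u < v → values u < values v
    values-mono {0} {1} _ _ = w₀<w₁
    values-mono {0} {2} _ _ = <-trans w₀<w₁ w₁<w₂
    values-mono {0} {3} _ _ = <-trans w₀<w₁ (<-trans w₁<w₂ w₂<w₃)
    values-mono {1} {2} _ _ = w₁<w₂
    values-mono {1} {3} _ _ = <-trans w₁<w₂ w₂<w₃
    values-mono {2} {3} _ _ = w₂<w₃
    values-mono {suc _} {1} _ (s≤s ())
    values-mono {suc (suc _)} {2} _ (s≤s (s≤s ()))
    values-mono {suc (suc (suc _))} {3} _ (s≤s (s≤s (s≤s ())))
    values-mono {_} {suc (suc (suc (suc _)))} (s≤s (s≤s (s≤s (s≤s ())))) _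

    contains-4123 : ∀ {σ} → w₃ ∷ w₀ ∷ w₁ ∷ w₂ ∷ [] ⊆ σ → Contains σ p4123
    contains-4123 s = _ , s , map-OrderIso values p4123 λ _ v∈ → values-mono (bound v∈)
      where
      bound : ∀ {v} → v ∈ p4123 → v < 4
      bound (here refl)                         = ≤-refl
      bound (there (here refl))                 = z<s
      bound (there (there (here refl)))         = s<s z<s
      bound (there (there (there (here refl)))) = s<s (s<s z<s)

    contains-1324 : ∀ {σ} → w₀ ∷ w₂ ∷ w₁ ∷ w₃ ∷ [] ⊆ σ → Contains σ p1324
    contains-1324 s = _ , s , map-OrderIso values p1324 λ _ v∈ → values-mono (bound v∈)
      where
      bound : ∀ {v} → v ∈ p1324 → v < 4
      bound (here refl)                         = z<s
      bound (there (here refl))                 = s<s (s<s z<s)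
      bound (there (there (here refl)))         = s<s z<s
      bound (there (there (there (here refl)))) = ≤-refl

  Avoids⇒Avoiding : ∀ {ρ} → Avoids (reverse ρ) p4123 → Avoids (reverse ρ) p1324 → Avoiding ρ
  Avoids⇒Avoiding ¬4123 ¬1324 = record
    { no-4231 = λ s d<b b<c c<a → ¬1324 (contains-1324 d<b b<c c<a (reverse⁺ s))
    ; no-3214 = λ s c<b b<a a<d → ¬4123 (contains-4123 c<b b<a a<d (reverse⁺ s))
    }

  private
    pattern i₀ = zero
    pattern i₁ = suc zero
    pattern i₂ = suc (suc zero)
    pattern i₃ = suc (suc (suc zero))

  Avoiding⇒¬4123 : ∀ {σ} → Avoiding (reverse σ) → Avoids σ p4123
  Avoiding⇒¬4123 V (a ∷ b ∷ c ∷ d ∷ [] , s , refl , iso) = no-3214 V (reverse⁺ s)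
    (Equivalence.from (iso i₁ i₂) (s≤s z≤n)) (Equivalence.from (iso i₂ i₃) (s≤s (s≤s z≤n))) (Equivalence.from (iso i₃ i₀) ≤-refl)

  Avoiding⇒¬1324 : ∀ {σ} → Avoiding (reverse σ) → Avoids σ p1324
  Avoiding⇒¬1324 V (a ∷ b ∷ c ∷ d ∷ [] , s , refl , iso) = no-4231 V (reverse⁺ s)
    (Equivalence.from (iso i₀ i₂) (s≤s z≤n)) (Equivalence.from (iso i₂ i₁) (s≤s (s≤s z≤n))) (Equivalence.from (iso i₁ i₃) ≤-refl)

  InClass⇔ : ∀ n σ → InClass n σ ⇔ (IsPerm n (reverse σ) × Avoiding (reverse σ))
  InClass⇔ n σ = mk⇔
    (λ { (P , ¬4123 , ¬1324) → ↭-trans (↭-reverse σ) P ,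
         Avoids⇒Avoiding (subst (λ τ → Avoids τ p4123) (sym (reverse-involutive σ)) ¬4123)
                         (subst (λ τ → Avoids τ p1324) (sym (reverse-involutive σ)) ¬1324) })
    (λ { (P , V) → ↭-trans (↭-sym (↭-reverse σ)) P , Avoiding⇒¬4123 V , Avoiding⇒¬1324 V })

  -- Duplicate-free lists with the same members are rearrangements of each other, so any one listing
  -- of the class determines the count.
  CountIs-length : ∀ {n c} Ls → Unique Ls → (∀ σ → σ ∈ Ls ⇔ InClass n σ) → CountIs n c → c ≡ length Ls
  CountIs-length Ls Ls! Ls-class (Ms , Ms! , Ms-class , refl) = ↭-length (∼bag⇒↭ (unique∧set⇒bag Ms! Ls! λ {σ} → mk⇔
    (Equivalence.from (Ls-class σ) ∘ Equivalence.to (Ms-class σ))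
    (Equivalence.from (Ms-class σ) ∘ Equivalence.to (Ls-class σ))))

  count-zero : ∀ {c} → CountIs 0 c → c ≡ 1
  count-zero = CountIs-length ([ [] ]) ([] ∷ []) λ σ → mk⇔
    (λ { (here refl) → ↭-refl , (λ { ([] , _ , () , _) ; (_ ∷ _ , () , _) }) , λ { ([] , _ , () , _) ; (_ ∷ _ , () , _) } })
    (λ { (P , _) → here (↭-empty-inv P) })

  count-suc : ∀ n {c} → CountIs (suc n) c → c ≡ descendants n (top₁ 0 0)
  count-suc n count = trans (CountIs-length (map reverse (words n)) (Unique.map⁺ reverse-injective (words-unique n)) class count)
    (trans (length-map reverse (words n)) (trans (length-map word (nodes n)) (length-nodes n)))
    where
    class : ∀ σ → σ ∈ map reverse (words n) ⇔ InClass (suc n) σ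
    class σ = mk⇔ to from
      where
      to : σ ∈ map reverse (words n) → InClass (suc n) σ
      to σ∈ with ρ , ρ∈ , refl ← ∈-map⁻ reverse σ∈ = Equivalence.from (InClass⇔ (suc n) (reverse ρ))
        (subst (λ τ → IsPerm (suc n) τ × Avoiding τ) (sym (reverse-involutive ρ)) (words-sound n ρ∈))
      from : InClass (suc n) σ → σ ∈ map reverse (words n)
      from cl with P , V ← Equivalence.to (InClass⇔ (suc n) σ) cl =
        subst (_∈ map reverse (words n)) (reverse-involutive σ) (∈-map⁺ reverse (words-complete n P V))

theorem1p1 : (a : ℕ → ℕ) → (∀ n → CountIs n (a n)) →
    ∀ (s : FPS) → IsSqrt1m4z s →
    poly (+ 2 ∷ []) ⊛ s ⊛ poly (+ 1 ∷ - + 3 ∷ + 1 ∷ []) ⊛ poly (+ 1 ∷ - + 3 ∷ + 1 ∷ []) ⊛ (λ n → + a n)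
    ≐ poly (+ 2 ∷ - + 13 ∷ + 26 ∷ - + 17 ∷ + 4 ∷ [])
    ⊖ poly (+ 0 ∷ + 1 ∷ - + 2 ∷ - + 1 ∷ []) ⊛ s
theorem1p1 a count = TreeSeries.generating-function a (Counting.count-zero (count 0)) (λ n → Counting.count-suc n (count (suc n)))
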